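{- Let $\mathfrak{a}=(a_1,\ldots,a_r)\in\mathbb{N}^r$, $\mathfrak{b}=(b_1,\ldots,b_s)\in\mathbb{N}^s$, $\boldsymbol{\epsilon}=(\epsilon_1,\ldots,\epsilon_r)\in(\mathbb{F}_q^\times)^r$, $\boldsymbol{\lambda}=(\lambda_1,\ldots,\lambda_s)\in(\mathbb{F}_q^\times)^s$. Then there exist a finite index set $I$ and, for each $i\in I$, an integer $l_i\le r+s$, positive integers $c_{i1},\ldots,c_{il_i}$, elements $\mu_{i1},\ldots,\mu_{il_i}\in\mathbb{F}_q^\times$ and $f''_i\in\mathbb{F}_p$, with $\sum_{m=1}^r a_m+\sum_{n=1}^s b_n=\sum_{h=1}^{l_i}c_{ih}$ and $\prod_{m=1}^r\epsilon_m\prod_{n=1}^s\lambda_n=\prod_{h=1}^{l_i}\mu_{ih}$, such that $$\zeta_A(\mathfrak{a};\boldsymbol{\epsilon})\,\zeta_A(\mathfrak{b};\boldsymbol{\lambda})=\sum_{i\in I}f''_i\,\zeta_A(c_{i1},\ldots,c_{il_i};\mu_{i1},\ldots,\mu_{il_i}).$$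
   Context: Let $q$ be a power of the prime $p$, $A=\mathbb{F}_q[\theta]$, $A_+$ the monic polynomials in $A$, $k_\infty=\mathbb{F}_q((1/\theta))$, $\mathbb{N}=\{1,2,\ldots\}$. For $\mathfrak{s}=(s_1,\ldots,s_r)\in\mathbb{N}^r$ and $\boldsymbol{\epsilon}=(\epsilon_1,\ldots,\epsilon_r)\in(\mathbb{F}_q^\times)^r$, the alternating multizeta value is $$\zeta_A(\mathfrak{s};\boldsymbol{\epsilon})=\sum_{\substack{a_1,\ldots,a_r\in A_+\\ \deg a_1>\cdots>\deg a_r\ge 0}}\frac{\epsilon_1^{\deg a_1}\cdots\epsilon_r^{\deg a_r}}{a_1^{s_1}\cdots a_r^{s_r}}\in k_\infty .$$ -}

module Defs where

open import Level using (Level; _⊔_)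
open import Algebra.Bundles using (CommutativeRing)
open import Data.Nat as ℕ using (ℕ; zero; suc)
open import Data.List as List using (List; []; _∷_; concatMap; foldr; zipWith; upTo; length)
open import Data.List.Relation.Unary.All using (All)
open import Data.List.Relation.Unary.Any using (Any)
open import Data.List.Relation.Unary.AllPairs using (AllPairs)
open import Data.Vec as Vec using (Vec; []; _∷_)
open import Data.Product using (Σ; _×_; _,_)
open import Relation.Nullary using (¬_)
open import Relation.Binary using (Decidable)

record FiniteField (c ℓ : Level) : Set (Level.suc (c ⊔ ℓ)) where
  field
    commRing  : CommutativeRing c ℓ
  open CommutativeRing commRing public
  field
    _≟_       : Decidable _≈_
    1≉0       : ¬ (1# ≈ 0#)
    inverse   : ∀ x → ¬ (x ≈ 0#) → Σ Carrier λ y → (x * y) ≈ 1#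
    elements  : List Carrier
    complete  : ∀ x → Any (x ≈_) elements
    distinct  : AllPairs (λ x y → ¬ (x ≈ y)) elements

module Zeta {c ℓ} (F : FiniteField c ℓ) where
  open FiniteField F

  -- the image of a natural number n in F (i.e. n · 1); the image of ℕ
  -- is exactly the prime field F_p ⊆ F.
  fromℕ : ℕ → Carrier
  fromℕ zero    = 0#
  fromℕ (suc n) = 1# + fromℕ n

  _^_ : Carrier → ℕ → Carrier
  x ^ zero  = 1#
  x ^ suc n = x * (x ^ n)

  Σl : List Carrier → Carrier
  Σl = foldr _+_ 0#

  -- Elements of k_∞ = F((1/θ)) that we need all lie in F[[x]], x = 1/θ
  -- (all multizeta values have nonnegative 1/θ-valuation).
  -- A power series is its coefficient function: n ↦ coefficient of x^n.
  PS : Set c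
  PS = ℕ → Carrier

  _≈PS_ : PS → PS → Set ℓ
  f ≈PS g = ∀ n → f n ≈ g n

  0PS 1PS : PS
  0PS _ = 0#
  1PS zero    = 1#
  1PS (suc _) = 0#

  _+PS_ : PS → PS → PS
  (f +PS g) n = f n + g n

  scalePS : Carrier → PS → PS
  scalePS a f n = a * f n

  _*PS_ : PS → PS → PS
  (f *PS g) n = Σl (List.map (λ k → f k * g (n ℕ.∸ k)) (upTo (suc n)))

  _^PS_ : PS → ℕ → PS
  f ^PS zero  = 1PS
  f ^PS suc n = f *PS (f ^PS n)

  shiftPS : ℕ → PS → PS
  shiftPS d f n with d ℕ.≤? n
  ... | Relation.Nullary.yes _ = f (n ℕ.∸ d)
  ... | Relation.Nullary.no  _ = 0#

  ΣPS : List PS → PS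
  ΣPS = foldr _+PS_ 0PS

  -- Inverse of a power series u with constant term 1:
  -- b₀ = 1, b_{n} = - Σ_{k=1}^{n} u_k b_{n-k}.
  -- invUpTo u n = [b_n, b_{n-1}, …, b_0].
  invUpTo : PS → ℕ → List Carrier
  invUpTo u zero    = 1# ∷ []
  invUpTo u (suc n) =
    let bs = invUpTo u n in
    (- Σl (zipWith _*_ (List.map (λ k → u (suc k)) (upTo (suc n))) bs)) ∷ bs

  headOr0 : List Carrier → Carrier
  headOr0 []      = 0#
  headOr0 (x ∷ _) = x

  invPS₁ : PS → PS
  invPS₁ u n = headOr0 (invUpTo u n)

  -- A monic polynomial of degree d,  a = θ^d + v₀ θ^{d-1} + … + v_{d-1},
  -- is encoded by v = (v₀,…,v_{d-1}) : Vec Carrier d.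
  Monic : ℕ → Set c
  Monic d = Vec Carrier d

  monics : (d : ℕ) → List (Monic d)
  monics zero    = [] ∷ []
  monics (suc d) = concatMap (λ x → List.map (x ∷_) (monics d)) elements

  -- θ^{-d} a = 1 + v₀ x + … + v_{d-1} x^d  as a power series in x = 1/θ
  normPS : ∀ {d} → Monic d → PS
  normPS v       zero          = 1#
  normPS []      (suc k)       = 0#
  normPS (x ∷ v) (suc zero)    = x
  normPS (x ∷ v) (suc (suc k)) = normPS v (suc k)

  -- 1/a = x^d · (θ^{-d} a)^{-1}
  recipPS : ∀ {d} → Monic d → PS
  recipPS {d} v = shiftPS d (invPS₁ (normPS v))

  Z : ℕ → List (ℕ × Carrier) → PS
  Z bound []              = 1PS
  Z bound ((s , e) ∷ rest) =
    ΣPS (List.map (λ d → ΣPS (List.map (λ v → scalePS (e ^ d) ((recipPS v ^PS s) *PS Z d rest))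
                                       (monics d)))
                  (upTo bound))

  -- ζ_A(𝔰; ε) ∈ F[[1/θ]] ⊆ k_∞.  Its coefficient of x^n = θ^{-n} only
  -- receives contributions from tuples with deg a₁ ≤ n (a term with
  -- deg a₁ = d has 1/θ-valuation Σ sᵢ deg aᵢ ≥ d), so the infinite sum is
  -- computed exactly by truncating at deg a₁ < n + 1.
  ζA : ∀ {r} → Vec ℕ r → Vec Carrier r → PS
  ζA 𝔰 ε n = Z (suc n) (Vec.toList (Vec.zip 𝔰 ε)) n

  ΣVℕ : ∀ {n} → Vec ℕ n → ℕ
  ΣVℕ = Vec.foldr _ ℕ._+_ 0

  ΠV : ∀ {n} → Vec Carrier n → Carrier
  ΠV = Vec.foldr _ _*_ 1#

  -- one summand  f'' · ζ_A(c₁,…,c_l; μ₁,…,μ_l)  of the right-hand side;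
  -- f'' ∈ F_p is given as the image of a natural number.
  record Summand : Set c where
    constructor summand
    field
      l  : ℕ
      cs : Vec ℕ l
      μs : Vec Carrier l
      f  : ℕ

{-# OPTIONS --safe #-}
-- Idea. For distinct monic m, n of degree d put f = m - n. From mn·(1/n - 1/m) = f we get
-- (1/m)(1/n) = (1/f)(1/n - 1/m), and iterating this until one of the exponents is used up writes
-- 1/(m^a n^b) through the 1/(f^j n^k) and 1/(f^j m^k) with j, k ≥ 1 and j + k = a + b. Summing over
-- m ≠ n, f runs over all nonzero polynomials of degree < d, that is over u·g with u a unit and g monic;
-- the sum of u^{-j} over the units lies in the prime field. Hence the product of two power sums of
-- degree d is an 𝔽ₚ-combination of S_d(a+b) and of the S_d(k)·S_{<d}(j). The product of two truncated
-- multizeta values splits according to whether the leading degrees satisfy d > e, d < e or d = e, and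
-- an induction on the total depth concludes, with coefficients that do not depend on the truncation.
module Submission where

open import Defs
open import Level using (Level; _⊔_)
open import Algebra.Bundles using (CommutativeRing)
import Algebra.Properties.CommutativeSemigroup as CommutativeSemigroupProperties
import Algebra.Properties.CommutativeSemiring.Exp as Exp
import Algebra.Properties.Ring as RingProperties
import Algebra.Properties.AbelianGroup as AbelianGroupProperties
import Algebra.Solver.Ring.NaturalCoefficients.Default as SemiringSolver
open import Data.Nat as ℕ using (ℕ; zero; suc; _≤_; _<_; z≤n; s≤s; _≤′_; ≤′-refl; ≤′-step)
open import Data.Nat.Properties as ℕₚ
  using (≤-refl; ≤-trans; ≤-reflexive; m≤m+n; m≤n+m; n≤1+n; +-suc; <-≤-trans; ≤⇒≤′; ≤′⇒≤)
import Data.Nat.Solver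
open import Data.List using (List; []; _∷_; map; foldr; _++_; concatMap; length; upTo; zipWith)
open import Data.List.Properties using (map-applyUpTo; map-upTo; upTo-∷ʳ)
open import Data.List.Relation.Unary.All as All using (All; []; _∷_)
open import Data.List.Relation.Unary.All.Properties using (¬All⇒Any¬)
open import Data.List.Relation.Unary.Any as Any using (Any; here; there)
open import Data.List.Relation.Unary.AllPairs using (AllPairs; []; _∷_)
open import Data.Vec as Vec using (Vec; []; _∷_)
import Data.Vec.Relation.Unary.All as VAll
open import Data.Vec.Relation.Binary.Pointwise.Inductive as Pointwise using (Pointwise; []; _∷_)
open import Data.Product using (∃; _×_; _,_; proj₁; proj₂)
open import Data.Sum using (_⊎_; inj₁; inj₂)
open import Data.Empty using (⊥-elim)
open import Relation.Nullary using (¬_; Dec; yes; no)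
open import Relation.Nullary.Decidable using (_⊎-dec_)
open import Relation.Binary.PropositionalEquality as ≡ using (_≡_)

private
  module ℕS = Data.Nat.Solver.+-*-Solver
  module ℕ+ = CommutativeSemigroupProperties ℕₚ.+-commutativeSemigroup

-- Coefficients must be images of natural numbers, so every minus sign of the partial fractions
-- requires `- 1#` to be such an image, and the unit sums must land there too. Both facts come from
-- reindexing sums over the field: by translation for the first, by multiplication with a unit for
-- the second. The range d = e shapes the induction. There S_d(k) S_{<d}(j) meets both tails
-- truncated at d, a triple product. But S_{<d}(j) is itself a truncated value of depth one with
-- twist 1, so it can be multiplied onto the expanded product of the tails without disturbing the
-- product of the twists. Since these expansions are used under a sum over d, they must hold at
-- every truncation with the same coefficients; the same uniformity later lets coefficient n of the
-- infinite sums be read off at truncation n + 1.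

choose : ∀ {p a} {P : Set p} {A : Set a} → Dec P → A → A → A
choose (yes _) x y = x
choose (no  _) x y = y

-- Finite sums in a commutative ring.

module RingFacts {a b} (R : CommutativeRing a b) where
  open CommutativeRing R
  open import Relation.Binary.Reasoning.Setoid setoid
  open RingProperties ring public
    using (-‿distribˡ-*; -‿distribʳ-*; -‿involutive; -‿+-comm; -0#≈0#; -1*x≈-x)
  open AbelianGroupProperties +-abelianGroup public
    using () renaming (inverseˡ-unique to +-inverseˡ-unique; x∙y⁻¹≈ε⇒x≈y to x-y≈0⇒x≈y; ⁻¹-anti-homo‿- to -[x-y]≈y-x)
  open CommutativeSemigroupProperties +-commutativeSemigroup public
    using () renaming (interchange to +-interchange)
  open CommutativeSemigroupProperties *-commutativeSemigroup public
    using () renaming (interchange to *-interchange; x∙yz≈y∙xz to x*yz≈y*xz)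
  open Exp commutativeSemiring public using (_^_; ^-congˡ; ^-homo-*; ^-distrib-*)

  +-sub : ∀ x y z w → (x + y) - (z + w) ≈ (x - z) + (y - w)
  +-sub x y z w = trans (+-congˡ (sym (-‿+-comm z w))) (+-interchange x y (- z) (- w))

  *-distribˡ-sub : ∀ x y z → x * (y - z) ≈ x * y - x * z
  *-distribˡ-sub x y z = trans (distribˡ x y (- z)) (+-congˡ (sym (-‿distribʳ-* x z)))

  *-distribʳ-sub : ∀ x y z → (y - z) * x ≈ y * x - z * x
  *-distribʳ-sub x y z = trans (distribʳ x y (- z)) (+-congˡ (sym (-‿distribˡ-* z x)))

  sub-cancel : ∀ x y → (x + y) - y ≈ x
  sub-cancel x y = trans (+-assoc x y (- y)) (trans (+-congˡ (-‿inverseʳ y)) (+-identityʳ x))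

  sub-add : ∀ x y → (x - y) + y ≈ x
  sub-add x y = trans (+-assoc x (- y) y) (trans (+-congˡ (-‿inverseˡ y)) (+-identityʳ x))

  x≈0∧y≈0⇒x-y≈0 : ∀ {x y} → x ≈ 0# → y ≈ 0# → x - y ≈ 0#
  x≈0∧y≈0⇒x-y≈0 x≈0 y≈0 = trans (+-cong x≈0 (-‿cong y≈0)) (-‿inverseʳ 0#)

  cancel-factor : ∀ {x y z w} → x * y ≈ 1# → z * x ≈ w * x → z ≈ w
  cancel-factor {x} {y} {z} {w} xy≈1 zx≈wx = begin
    z            ≈⟨ *-identityʳ z ⟨
    z * 1#       ≈⟨ *-congˡ xy≈1 ⟨
    z * (x * y)  ≈⟨ *-assoc z x y ⟨
    (z * x) * y  ≈⟨ *-congʳ zx≈wx ⟩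
    (w * x) * y  ≈⟨ *-assoc w x y ⟩
    w * (x * y)  ≈⟨ *-congˡ xy≈1 ⟩
    w * 1#       ≈⟨ *-identityʳ w ⟩
    w            ∎

  inverse-unique : ∀ {x y z} → x * y ≈ 1# → x * z ≈ 1# → y ≈ z
  inverse-unique {x} {y} {z} xy≈1 xz≈1 =
    cancel-factor xy≈1 (trans (*-comm y x) (trans xy≈1 (trans (sym xz≈1) (*-comm x z))))

  0^1+n≈0 : ∀ {x} n → x ≈ 0# → x ^ suc n ≈ 0#
  0^1+n≈0 n x≈0 = trans (*-congʳ x≈0) (zeroˡ _)

  1^n≈1 : ∀ n → 1# ^ n ≈ 1#
  1^n≈1 zero    = refl
  1^n≈1 (suc n) = trans (*-identityˡ _) (1^n≈1 n)

  ∑ : ∀ {i} {A : Set i} → List A → (A → Carrier) → Carrier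
  ∑ xs f = foldr _+_ 0# (map f xs)

  module _ {i} {A : Set i} where

    ∑-cong : ∀ (xs : List A) {f g : A → Carrier} → (∀ x → f x ≈ g x) → ∑ xs f ≈ ∑ xs g
    ∑-cong []       f≈g = refl
    ∑-cong (x ∷ xs) f≈g = +-cong (f≈g x) (∑-cong xs f≈g)

    ∑-zero : ∀ (xs : List A) → ∑ xs (λ _ → 0#) ≈ 0#
    ∑-zero []       = refl
    ∑-zero (x ∷ xs) = trans (+-identityˡ _) (∑-zero xs)

    ∑-+ : ∀ (xs : List A) (f g : A → Carrier) → ∑ xs (λ x → f x + g x) ≈ ∑ xs f + ∑ xs g
    ∑-+ []       f g = sym (+-identityˡ 0#)
    ∑-+ (x ∷ xs) f g = trans (+-congˡ (∑-+ xs f g)) (+-interchange (f x) (g x) (∑ xs f) (∑ xs g))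

    *-∑ : ∀ r (xs : List A) (f : A → Carrier) → r * ∑ xs f ≈ ∑ xs (λ x → r * f x)
    *-∑ r []       f = zeroʳ r
    *-∑ r (x ∷ xs) f = trans (distribˡ r _ _) (+-congˡ (*-∑ r xs f))

    ∑-* : ∀ r (xs : List A) (f : A → Carrier) → ∑ xs f * r ≈ ∑ xs (λ x → f x * r)
    ∑-* r xs f = trans (*-comm _ r) (trans (*-∑ r xs f) (∑-cong xs (λ x → *-comm r (f x))))

    ∑-neg : ∀ (xs : List A) (f : A → Carrier) → ∑ xs (λ x → - f x) ≈ - ∑ xs f
    ∑-neg []       f = sym -0#≈0#
    ∑-neg (x ∷ xs) f = trans (+-congˡ (∑-neg xs f)) (-‿+-comm _ _)

    ∑-++ : ∀ (xs ys : List A) (f : A → Carrier) → ∑ (xs ++ ys) f ≈ ∑ xs f + ∑ ys f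
    ∑-++ []       ys f = sym (+-identityˡ _)
    ∑-++ (x ∷ xs) ys f = trans (+-congˡ (∑-++ xs ys f)) (sym (+-assoc _ _ _))

  module _ {i j} {A : Set i} {B : Set j} where

    ∑-swap : ∀ (xs : List A) (ys : List B) (f : A → B → Carrier) →
             ∑ xs (λ x → ∑ ys (f x)) ≈ ∑ ys (λ y → ∑ xs (λ x → f x y))
    ∑-swap []       ys f = sym (∑-zero ys)
    ∑-swap (x ∷ xs) ys f = trans (+-congˡ (∑-swap xs ys f)) (sym (∑-+ ys (f x) _))

    ∑-map : ∀ (g : A → B) (xs : List A) (f : B → Carrier) → ∑ (map g xs) f ≈ ∑ xs (λ x → f (g x))
    ∑-map g []       f = refl
    ∑-map g (x ∷ xs) f = +-congˡ (∑-map g xs f)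

    ∑-concatMap : ∀ (g : A → List B) (xs : List A) (f : B → Carrier) →
                  ∑ (concatMap g xs) f ≈ ∑ xs (λ x → ∑ (g x) f)
    ∑-concatMap g []       f = refl
    ∑-concatMap g (x ∷ xs) f = trans (∑-++ (g x) _ f) (+-congˡ (∑-concatMap g xs f))

  ∑-sub : ∀ {i} {A : Set i} (xs : List A) f g → ∑ xs (λ x → f x - g x) ≈ ∑ xs f - ∑ xs g
  ∑-sub xs f g = trans (∑-+ xs f (λ x → - g x)) (+-congˡ (∑-neg xs g))

  -- The recursion splits off the largest index, that is the leading degree; a sum over `upTo` would
  -- unfold at the wrong end.
  σ : ℕ → (ℕ → Carrier) → Carrier
  σ zero    h = 0#
  σ (suc n) h = σ n h + h n

  σ-cong : ∀ n {g h : ℕ → Carrier} → (∀ d → g d ≈ h d) → σ n g ≈ σ n h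
  σ-cong zero    g≈h = refl
  σ-cong (suc n) g≈h = +-cong (σ-cong n g≈h) (g≈h n)

  σ-zero : ∀ n → σ n (λ _ → 0#) ≈ 0#
  σ-zero zero    = refl
  σ-zero (suc n) = trans (+-identityʳ _) (σ-zero n)

  σ-+ : ∀ n g h → σ n (λ d → g d + h d) ≈ σ n g + σ n h
  σ-+ zero    g h = sym (+-identityˡ 0#)
  σ-+ (suc n) g h = trans (+-congʳ (σ-+ n g h)) (+-interchange _ _ _ _)

  σ-neg : ∀ n h → σ n (λ d → - h d) ≈ - σ n h
  σ-neg zero    h = sym -0#≈0#
  σ-neg (suc n) h = trans (+-congʳ (σ-neg n h)) (-‿+-comm _ _)

  *-σ : ∀ r n h → r * σ n h ≈ σ n (λ d → r * h d)
  *-σ r zero    h = zeroʳ r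
  *-σ r (suc n) h = trans (distribˡ r _ _) (+-congʳ (*-σ r n h))

  -- The three ranges are d > e, d < e and d = e.
  σ-* : ∀ n g h → σ n g * σ n h
      ≈ (σ n (λ d → g d * σ d h) + σ n (λ d → h d * σ d g)) + σ n (λ d → g d * h d)
  σ-* zero    g h = trans (zeroˡ 0#) (sym (trans (+-identityʳ _) (+-identityʳ _)))
  σ-* (suc n) g h = begin
    (G + g n) * (H + h n)
      ≈⟨ solve 4 (λ G g H h → (G :+ g) :* (H :+ h) := G :* H :+ (g :* H :+ h :* G :+ g :* h)) refl G (g n) H (h n) ⟩
    G * H + (g n * H + h n * G + g n * h n)
      ≈⟨ +-congʳ (σ-* n g h) ⟩
    (P + Q + S) + (g n * H + h n * G + g n * h n)
      ≈⟨ solve 6 (λ P Q S u v w → (P :+ Q :+ S) :+ (u :+ v :+ w) := (P :+ u) :+ (Q :+ v) :+ (S :+ w)) refl P Q S _ _ _ ⟩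
    (P + g n * H) + (Q + h n * G) + (S + g n * h n) ∎
    where
    open SemiringSolver commutativeSemiring
    G H P Q S : Carrier
    G = σ n g
    H = σ n h
    P = σ n (λ d → g d * σ d h)
    Q = σ n (λ d → h d * σ d g)
    S = σ n (λ d → g d * h d)

  ∑-upTo : ∀ n h → ∑ (upTo n) h ≈ σ n h
  ∑-upTo zero    h = refl
  ∑-upTo (suc n) h = begin
    ∑ (upTo (suc n)) h       ≡⟨ ≡.cong (λ xs → ∑ xs h) (upTo-∷ʳ n) ⟨
    ∑ (upTo n ++ n ∷ []) h   ≈⟨ ∑-++ (upTo n) (n ∷ []) h ⟩
    ∑ (upTo n) h + (h n + 0#) ≈⟨ +-cong (∑-upTo n h) (+-identityʳ (h n)) ⟩
    σ n h + h n              ∎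

-- Sums over the elements of the finite field.

module ElementSums {c ℓ a b} (F : FiniteField c ℓ) (R : CommutativeRing a b) where
  private module 𝔽 = FiniteField F
  open CommutativeRing R
  open RingFacts R
  open import Relation.Binary.Reasoning.Setoid setoid

  private
    ∑-pick-∉ : ∀ {xs y} (g : 𝔽.Carrier → Carrier) → All (λ x → ¬ (y 𝔽.≈ x)) xs →
               ∑ xs (λ x → choose (x 𝔽.≟ y) (g x) 0#) ≈ 0#
    ∑-pick-∉ g [] = refl
    ∑-pick-∉ {x ∷ xs} {y} g (y≉x ∷ y∉xs) with x 𝔽.≟ y
    ... | yes x≈y = ⊥-elim (y≉x (𝔽.sym x≈y))
    ... | no  _   = trans (+-identityˡ _) (∑-pick-∉ g y∉xs)

    ∑-pick-∈ : ∀ {xs y} (g : 𝔽.Carrier → Carrier) → (∀ {x z} → x 𝔽.≈ z → g x ≈ g z) →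
               Any (y 𝔽.≈_) xs → AllPairs (λ x z → ¬ (x 𝔽.≈ z)) xs →
               ∑ xs (λ x → choose (x 𝔽.≟ y) (g x) 0#) ≈ g y
    ∑-pick-∈ {x ∷ xs} {y} g g-cong (here y≈x) (x∉xs ∷ _) with x 𝔽.≟ y
    ... | yes x≈y = trans (+-cong (g-cong x≈y)
                            (∑-pick-∉ g (All.map (λ x≉z y≈z → x≉z (𝔽.trans x≈y y≈z)) x∉xs)))
                          (+-identityʳ _)
    ... | no  x≉y = ⊥-elim (x≉y (𝔽.sym y≈x))
    ∑-pick-∈ {x ∷ xs} {y} g g-cong (there y∈xs) (x∉xs ∷ distinct) with x 𝔽.≟ y
    ... | yes x≈y = ⊥-elim (All.lookupWith (λ x≉z y≈z → x≉z (𝔽.trans x≈y y≈z)) x∉xs y∈xs)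
    ... | no  _   = trans (+-identityˡ _) (∑-pick-∈ g g-cong y∈xs distinct)

  -- Completeness supplies an entry equal to `y` and distinctness makes it the only one. That entry
  -- is merely equivalent to `y`, whence the congruence of `g`.
  ∑-pick : ∀ y (g : 𝔽.Carrier → Carrier) → (∀ {x z} → x 𝔽.≈ z → g x ≈ g z) →
           ∑ 𝔽.elements (λ x → choose (x 𝔽.≟ y) (g x) 0#) ≈ g y
  ∑-pick y g g-cong = ∑-pick-∈ g g-cong (𝔽.complete y) 𝔽.distinct

  -- Insert 1 = Σ_y [y = π x], exchange the sums and rewrite the bracket as [x = π⁻¹ y].
  ∑-bijection : (π π⁻¹ : 𝔽.Carrier → 𝔽.Carrier) →
    (∀ {x y} → x 𝔽.≈ y → π x 𝔽.≈ π y) → (∀ {x y} → x 𝔽.≈ y → π⁻¹ x 𝔽.≈ π⁻¹ y) →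
    (∀ x → π (π⁻¹ x) 𝔽.≈ x) → (∀ x → π⁻¹ (π x) 𝔽.≈ x) →
    (f : 𝔽.Carrier → Carrier) → (∀ {x y} → x 𝔽.≈ y → f x ≈ f y) →
    ∑ 𝔽.elements (λ x → f (π x)) ≈ ∑ 𝔽.elements f
  ∑-bijection π π⁻¹ π-cong π⁻¹-cong ππ⁻¹ π⁻¹π f f-cong = begin
    ∑ E (λ x → f (π x))
      ≈⟨ ∑-cong E (λ x → ∑-pick (π x) f f-cong) ⟨
    ∑ E (λ x → ∑ E (λ y → choose (y 𝔽.≟ π x) (f y) 0#))
      ≈⟨ ∑-swap E E _ ⟩
    ∑ E (λ y → ∑ E (λ x → choose (y 𝔽.≟ π x) (f y) 0#))
      ≈⟨ ∑-cong E (λ y → ∑-cong E (λ x → adjoint x y)) ⟩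
    ∑ E (λ y → ∑ E (λ x → choose (x 𝔽.≟ π⁻¹ y) (f y) 0#))
      ≈⟨ ∑-cong E (λ y → ∑-pick (π⁻¹ y) (λ _ → f y) (λ _ → refl)) ⟩
    ∑ E f ∎
    where
    E : List 𝔽.Carrier
    E = 𝔽.elements
    adjoint : ∀ x y → choose (y 𝔽.≟ π x) (f y) 0# ≈ choose (x 𝔽.≟ π⁻¹ y) (f y) 0#
    adjoint x y with y 𝔽.≟ π x | x 𝔽.≟ π⁻¹ y
    ... | yes _   | yes _   = refl
    ... | no  _   | no  _   = refl
    ... | yes y≈  | no  x≉  = ⊥-elim (x≉ (𝔽.trans (𝔽.sym (π⁻¹π x)) (π⁻¹-cong (𝔽.sym y≈))))
    ... | no  y≉  | yes x≈  = ⊥-elim (y≉ (𝔽.trans (𝔽.sym (ππ⁻¹ y)) (π-cong (𝔽.sym x≈))))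

-- Inverses, the prime field and power sums of units.

module PrimeField {c ℓ} (F : FiniteField c ℓ) where
  open FiniteField F
  open Zeta F using (fromℕ)
  open RingFacts commRing
  open ElementSums F commRing
  open import Relation.Binary.Reasoning.Setoid setoid

  -- Total, with the junk value ι 0 = 0, which makes ι a bijection.
  ι : Carrier → Carrier
  ι x with x ≟ 0#
  ... | yes _   = 0#
  ... | no  x≉0 = proj₁ (inverse x x≉0)

  *-ι : ∀ {x} → ¬ (x ≈ 0#) → x * ι x ≈ 1#
  *-ι {x} x≉0 with x ≟ 0#
  ... | yes x≈0  = ⊥-elim (x≉0 x≈0)
  ... | no  x≉0′ = proj₂ (inverse x x≉0′)

  ι-zero : ∀ {x} → x ≈ 0# → ι x ≈ 0#
  ι-zero {x} x≈0 with x ≟ 0#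
  ... | yes _   = refl
  ... | no  x≉0 = ⊥-elim (x≉0 x≈0)

  factor≉0 : ∀ {x y} → x * y ≈ 1# → ¬ (y ≈ 0#)
  factor≉0 {x} xy≈1 y≈0 = 1≉0 (trans (sym xy≈1) (trans (*-congˡ y≈0) (zeroʳ x)))

  ι≉0 : ∀ {x} → ¬ (x ≈ 0#) → ¬ (ι x ≈ 0#)
  ι≉0 x≉0 = factor≉0 (*-ι x≉0)

  *≉0 : ∀ {x y} → ¬ (x ≈ 0#) → ¬ (y ≈ 0#) → ¬ (x * y ≈ 0#)
  *≉0 {x} {y} x≉0 y≉0 xy≈0 = y≉0 (begin
    y              ≈⟨ *-identityˡ y ⟨
    1# * y         ≈⟨ *-congʳ (*-ι x≉0) ⟨
    (x * ι x) * y  ≈⟨ *-congʳ (*-comm x (ι x)) ⟩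
    (ι x * x) * y  ≈⟨ *-assoc _ _ _ ⟩
    ι x * (x * y)  ≈⟨ *-congˡ xy≈0 ⟩
    ι x * 0#       ≈⟨ zeroʳ _ ⟩
    0#             ∎)

  ι-unique : ∀ {x y} → x * y ≈ 1# → ι x ≈ y
  ι-unique {x} {y} xy≈1 =
    inverse-unique (*-ι (factor≉0 (trans (*-comm y x) xy≈1))) xy≈1

  ι-cong : ∀ {x y} → x ≈ y → ι x ≈ ι y
  ι-cong {x} {y} x≈y with x ≟ 0#
  ... | yes x≈0 = sym (ι-zero (trans (sym x≈y) x≈0))
  ... | no  x≉0 = sym (ι-unique (trans (*-congʳ (sym x≈y)) (proj₂ (inverse x x≉0))))

  ι-involutive : ∀ x → ι (ι x) ≈ x
  ι-involutive x with x ≟ 0#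
  ... | yes x≈0 = trans (ι-zero refl) (sym x≈0)
  ... | no  x≉0 = ι-unique (trans (*-comm _ x) (proj₂ (inverse x x≉0)))

  ι-neg : ∀ {x} → ¬ (x ≈ 0#) → ι (- x) ≈ - ι x
  ι-neg {x} x≉0 = ι-unique (begin
    - x * - ι x      ≈⟨ -‿distribˡ-* x (- ι x) ⟨
    - (x * - ι x)    ≈⟨ -‿cong (-‿distribʳ-* x (ι x)) ⟨
    - - (x * ι x)    ≈⟨ -‿involutive _ ⟩
    x * ι x          ≈⟨ *-ι x≉0 ⟩
    1#               ∎)

  cancel : ∀ {x y} → x * y ≈ 1# → ∀ z → x * (y * z) ≈ z
  cancel xy≈1 z = trans (sym (*-assoc _ _ z)) (trans (*-congʳ xy≈1) (*-identityˡ z))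

  -- The witness is a natural number because summands store their coefficients that way; closure
  -- under negation is therefore not built in and comes from `𝔽ₚ--1`.
  𝔽ₚ : Carrier → Set ℓ
  𝔽ₚ x = ∃ λ n → fromℕ n ≈ x

  fromℕ-+ : ∀ m n → fromℕ (m ℕ.+ n) ≈ fromℕ m + fromℕ n
  fromℕ-+ zero    n = sym (+-identityˡ _)
  fromℕ-+ (suc m) n = trans (+-congˡ (fromℕ-+ m n)) (sym (+-assoc _ _ _))

  fromℕ-* : ∀ m n → fromℕ (m ℕ.* n) ≈ fromℕ m * fromℕ n
  fromℕ-* zero    n = sym (zeroˡ _)
  fromℕ-* (suc m) n = begin
    fromℕ (n ℕ.+ m ℕ.* n)             ≈⟨ fromℕ-+ n (m ℕ.* n) ⟩
    fromℕ n + fromℕ (m ℕ.* n)         ≈⟨ +-cong (sym (*-identityˡ _)) (fromℕ-* m n) ⟩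
    1# * fromℕ n + fromℕ m * fromℕ n  ≈⟨ distribʳ _ _ _ ⟨
    (1# + fromℕ m) * fromℕ n          ∎

  𝔽ₚ-0 : 𝔽ₚ 0#
  𝔽ₚ-0 = 0 , refl

  𝔽ₚ-1 : 𝔽ₚ 1#
  𝔽ₚ-1 = 1 , +-identityʳ 1#

  𝔽ₚ-* : ∀ {x y} → 𝔽ₚ x → 𝔽ₚ y → 𝔽ₚ (x * y)
  𝔽ₚ-* (m , m≈x) (n , n≈y) = m ℕ.* n , trans (fromℕ-* m n) (*-cong m≈x n≈y)

  𝔽ₚ-^ : ∀ {x} n → 𝔽ₚ x → 𝔽ₚ (x ^ n)
  𝔽ₚ-^ zero    x∈𝔽ₚ = 𝔽ₚ-1
  𝔽ₚ-^ (suc n) x∈𝔽ₚ = 𝔽ₚ-* x∈𝔽ₚ (𝔽ₚ-^ n x∈𝔽ₚ)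

  𝔽ₚ-∑ : ∀ {f : Carrier → Carrier} {xs} → All (λ x → 𝔽ₚ (f x)) xs → 𝔽ₚ (∑ xs f)
  𝔽ₚ-∑ []                  = 𝔽ₚ-0
  𝔽ₚ-∑ ((m , m≈fx) ∷ fxs) with 𝔽ₚ-∑ fxs
  ... | n , n≈∑ = m ℕ.+ n , trans (fromℕ-+ m n) (+-cong m≈fx n≈∑)

  ∑1≈fromℕ : ∀ (xs : List Carrier) → ∑ xs (λ _ → 1#) ≈ fromℕ (length xs)
  ∑1≈fromℕ []       = refl
  ∑1≈fromℕ (x ∷ xs) = +-congˡ (∑1≈fromℕ xs)

  ∑-translate : ∀ y (f : Carrier → Carrier) → (∀ {x z} → x ≈ z → f x ≈ f z) →
                ∑ elements (λ x → f (x - y)) ≈ ∑ elements f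
  ∑-translate y = ∑-bijection (_- y) (_+ y) +-congʳ +-congʳ (λ x → sub-cancel x y) (λ x → sub-add x y)

  -- The sum of all elements is invariant under translation by 1.
  fromℕ-q≈0 : fromℕ (length elements) ≈ 0#
  fromℕ-q≈0 = begin
    fromℕ (length elements)   ≈⟨ ∑1≈fromℕ elements ⟨
    N                         ≈⟨ -‿involutive N ⟨
    - - N                     ≈⟨ -‿cong (+-inverseˡ-unique _ _ s+N) ⟨
    - 0#                      ≈⟨ -0#≈0# ⟩
    0#                        ∎
    where
    N s : Carrier
    N = ∑ elements (λ _ → 1#)
    s = ∑ elements (λ x → x)
    s-N : s - N ≈ s
    s-N = begin
      s - N                                ≈⟨ +-congˡ (∑-neg elements (λ _ → 1#)) ⟨
      s + ∑ elements (λ _ → - 1#)          ≈⟨ ∑-+ elements (λ x → x) (λ _ → - 1#) ⟨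
      ∑ elements (λ x → x - 1#)            ≈⟨ ∑-translate 1# (λ x → x) (λ e → e) ⟩
      s                                    ∎
    s+N : 0# + N ≈ 0#
    s+N = begin
      0# + N              ≈⟨ +-congʳ (-‿inverseʳ s) ⟨
      (s - s) + N         ≈⟨ +-congʳ (+-congʳ s-N) ⟨
      ((s - N) - s) + N   ≈⟨ +-congʳ (+-comm _ _) ⟩
      (- s + (s - N)) + N ≈⟨ +-assoc _ _ _ ⟩
      - s + ((s - N) + N) ≈⟨ +-congˡ (sub-add s N) ⟩
      - s + s             ≈⟨ -‿inverseˡ s ⟩
      0#                  ∎

  -- As q times 1 vanishes, -1 is the image of q - 1. The list of elements contains `0#`, so its
  -- length has a predecessor.
  𝔽ₚ--1 : 𝔽ₚ (- 1#)
  𝔽ₚ--1 = predecessor elements (complete 0#) fromℕ-q≈0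
    where
    predecessor : ∀ xs → Any (0# ≈_) xs → fromℕ (length xs) ≈ 0# → 𝔽ₚ (- 1#)
    predecessor (x ∷ xs) _ 1+n≈0 = length xs , +-inverseˡ-unique _ _ (trans (+-comm _ _) 1+n≈0)

  -- For `j ≥ 1` the entry 0 contributes nothing, since `ι` sends it to 0, and what remains is the
  -- sum of the inverse powers of the units.
  powerSum : ℕ → Carrier
  powerSum j = ∑ elements (λ x → ι x ^ j)

  -- The power sum is fixed by multiplication with u ^ j for every unit u, so it
  -- vanishes unless all its terms are 0 or 1.
  𝔽ₚ-powerSum : ∀ j → 𝔽ₚ (powerSum (suc j))
  𝔽ₚ-powerSum j = go (All.all? (λ x → P? x) elements)
    where
    k : ℕ
    k = suc j
    P : Carrier → Set ℓ
    P x = (ι x ≈ 0#) ⊎ (ι x ^ k ≈ 1#)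
    P? : ∀ x → Dec (P x)
    P? x = (ι x ≟ 0#) ⊎-dec ((ι x ^ k) ≟ 1#)
    member : ∀ {x} → P x → 𝔽ₚ (ι x ^ k)
    member (inj₁ x≈0)  = 0 , sym (0^1+n≈0 j x≈0)
    member (inj₂ xᵏ≈1) = proj₁ 𝔽ₚ-1 , trans (proj₂ 𝔽ₚ-1) (sym xᵏ≈1)
    Q : Carrier
    Q = ∑ elements (λ x → x ^ k)
    -- Inversion permutes the field, so powers replace inverse powers and multiplication by `u` acts
    -- as a plain reindexing.
    powerSum≈Q : powerSum k ≈ Q
    powerSum≈Q = ∑-bijection ι ι ι-cong ι-cong ι-involutive ι-involutive (_^ k) (^-congˡ k)
    scale : ∀ {u} → ¬ (u ≈ 0#) → u ^ k * Q ≈ Q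
    scale {u} u≉0 = begin
      u ^ k * Q                            ≈⟨ *-∑ (u ^ k) elements (_^ k) ⟩
      ∑ elements (λ x → u ^ k * x ^ k)     ≈⟨ ∑-cong elements (λ x → ^-distrib-* u x k) ⟨
      ∑ elements (λ x → (u * x) ^ k)       ≈⟨ ∑-bijection (u *_) (ι u *_) *-congˡ *-congˡ
                                                (cancel (*-ι u≉0)) (cancel (trans (*-comm _ u) (*-ι u≉0)))
                                                (_^ k) (^-congˡ k) ⟩
      Q                                    ∎
    vanish : ∀ {u} → ¬ (u ≈ 0#) → ¬ (u ^ k ≈ 1#) → Q ≈ 0#
    vanish {u} u≉0 uᵏ≉1 with Q ≟ 0#
    ... | yes Q≈0 = Q≈0
    ... | no  Q≉0 = ⊥-elim (*≉0 (λ e → uᵏ≉1 (x-y≈0⇒x≈y _ _ e)) Q≉0 (begin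
      (u ^ k - 1#) * Q      ≈⟨ *-distribʳ-sub Q (u ^ k) 1# ⟩
      u ^ k * Q - 1# * Q    ≈⟨ +-cong (scale u≉0) (-‿cong (*-identityˡ Q)) ⟩
      Q - Q                 ≈⟨ -‿inverseʳ Q ⟩
      0#                    ∎))
    go : Dec (All P elements) → 𝔽ₚ (powerSum k)
    go (yes ps) = 𝔽ₚ-∑ (All.map member ps)
    go (no ¬ps) with Any.satisfied (¬All⇒Any¬ P? elements ¬ps)
    ... | x , ¬px = 0 , sym (trans powerSum≈Q (vanish (λ e → ¬px (inj₁ e)) (λ e → ¬px (inj₂ e))))

-- The abstract ring that stands for power series in 1/θ.

-- An F-algebra with an element X (playing the role of 1/θ) in which all the
-- elements 1 + T v are invertible; for a monic polynomial m of degree d encoded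
-- by v, 1 + T v is θ^{-d} m and X ^ d * V v is 1/m.
record SeriesRing {c ℓ} (F : FiniteField c ℓ) (a b : Level) : Set (c ⊔ ℓ ⊔ Level.suc (a ⊔ b)) where
  private module 𝔽 = FiniteField F
  field
    commutativeRing : CommutativeRing a b
  open CommutativeRing commutativeRing
  field
    C      : 𝔽.Carrier → Carrier
    C-cong : ∀ {x y} → x 𝔽.≈ y → C x ≈ C y
    C-+    : ∀ x y → C (x 𝔽.+ y) ≈ C x + C y
    C-*    : ∀ x y → C (x 𝔽.* y) ≈ C x * C y
    C-1    : C 𝔽.1# ≈ 1#
    X      : Carrier
  T : ∀ {d} → Vec 𝔽.Carrier d → Carrier
  T v = Vec.foldr (λ _ → Carrier) (λ x t → X * (C x + t)) 0# v
  field
    V         : ∀ {d} → Vec 𝔽.Carrier d → Carrier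
    V-inverse : ∀ {d} (v : Vec 𝔽.Carrier d) → (1# + T v) * V v ≈ 1#

-- Partial fractions for two monic polynomials of the same degree.

module Harmonic {c ℓ a b} (F : FiniteField c ℓ) (𝓡 : SeriesRing F a b) where
  private
    module 𝔽 = FiniteField F
    module 𝔽′ = RingFacts 𝔽.commRing
  open Zeta F using (fromℕ; Monic; monics)
  open PrimeField F
  open SeriesRing 𝓡
  open CommutativeRing commutativeRing
  open RingFacts commutativeRing
  open ElementSums F commutativeRing
  open import Relation.Binary.Reasoning.Setoid setoid

  infix 4 _≋_
  _≋_ : ∀ {d} → Monic d → Monic d → Set (c ⊔ ℓ)
  _≋_ = Pointwise 𝔽._≈_

  C-0 : C 𝔽.0# ≈ 0#
  C-0 = begin
    C 𝔽.0#                        ≈⟨ sub-cancel _ _ ⟨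
    (C 𝔽.0# + C 𝔽.0#) - C 𝔽.0#    ≈⟨ +-congʳ (C-+ _ _) ⟨
    C (𝔽.0# 𝔽.+ 𝔽.0#) - C 𝔽.0#    ≈⟨ +-congʳ (C-cong (𝔽.+-identityˡ _)) ⟩
    C 𝔽.0# - C 𝔽.0#               ≈⟨ -‿inverseʳ _ ⟩
    0#                            ∎

  C-neg : ∀ x → C (𝔽.- x) ≈ - C x
  C-neg x = +-inverseˡ-unique _ _ (trans (sym (C-+ _ _)) (trans (C-cong (𝔽.-‿inverseˡ x)) C-0))

  C-sub : ∀ x y → C (x 𝔽.- y) ≈ C x - C y
  C-sub x y = trans (C-+ x (𝔽.- y)) (+-congˡ (C-neg y))

  C-^ : ∀ x n → C (x 𝔽′.^ n) ≈ C x ^ n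
  C-^ x zero    = C-1
  C-^ x (suc n) = trans (C-* x _) (*-congˡ (C-^ x n))

  C-∑ : ∀ (xs : List 𝔽.Carrier) f → C (𝔽′.∑ xs f) ≈ ∑ xs (λ x → C (f x))
  C-∑ []       f = C-0
  C-∑ (x ∷ xs) f = trans (C-+ _ _) (+-congˡ (C-∑ xs f))

  T-cong : ∀ {d} {v w : Monic d} → v ≋ w → T v ≈ T w
  T-cong []          = refl
  T-cong (x≈y ∷ v≋w) = *-congˡ (+-cong (C-cong x≈y) (T-cong v≋w))

  V-cong : ∀ {d} {v w : Monic d} → v ≋ w → V v ≈ V w
  V-cong {v = v} {w} v≋w =
    inverse-unique (V-inverse v) (trans (*-congʳ (+-congˡ (T-cong v≋w))) (V-inverse w))

  α : ∀ {d} → Monic d → Carrier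
  α {d} v = X ^ d * V v

  α-cong : ∀ {d} {v w : Monic d} → v ≋ w → α v ≈ α w
  α-cong v≋w = *-congˡ (V-cong v≋w)

  φ : ∀ {d} → 𝔽.Carrier → Monic d → Monic d → Monic d
  φ k []      []      = []
  φ k (x ∷ v) (y ∷ w) = k 𝔽.* (x 𝔽.- y) ∷ φ k v w

  T-sub : ∀ {d} x y (v w : Monic d) →
          T (x ∷ v) - T (y ∷ w) ≈ X * (C (x 𝔽.- y) + (T v - T w))
  T-sub x y v w = begin
    X * (C x + T v) - X * (C y + T w)  ≈⟨ *-distribˡ-sub X _ _ ⟨
    X * ((C x + T v) - (C y + T w))    ≈⟨ *-congˡ (+-sub _ _ _ _) ⟩
    X * ((C x - C y) + (T v - T w))    ≈⟨ *-congˡ (+-congʳ (C-sub x y)) ⟨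
    X * (C (x 𝔽.- y) + (T v - T w))    ∎

  T-φ : ∀ {d} k (v w : Monic d) → T (φ k v w) ≈ C k * (T v - T w)
  T-φ k []      []      = sym (trans (*-congˡ (-‿inverseʳ 0#)) (zeroʳ _))
  T-φ k (x ∷ v) (y ∷ w) = begin
    X * (C (k 𝔽.* (x 𝔽.- y)) + T (φ k v w))
      ≈⟨ *-congˡ (+-cong (C-* k _) (T-φ k v w)) ⟩
    X * (C k * C (x 𝔽.- y) + C k * (T v - T w))
      ≈⟨ *-congˡ (distribˡ (C k) _ _) ⟨
    X * (C k * (C (x 𝔽.- y) + (T v - T w)))
      ≈⟨ x*yz≈y*xz X (C k) _ ⟩
    C k * (X * (C (x 𝔽.- y) + (T v - T w)))
      ≈⟨ *-congˡ (T-sub x y v w) ⟨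
    C k * (T (x ∷ v) - T (y ∷ w)) ∎

  -- 1/(m - n) for monic m ≠ n of the same degree, and 0 if m = n: when x ≠ y,
  -- m - n is x - y times the monic polynomial encoded by φ (ι (x - y)) v w.
  D : ∀ {d} → Monic d → Monic d → Carrier
  D []      []      = 0#
  D (x ∷ v) (y ∷ w) = choose (x 𝔽.≟ y) (D v w) (C (ι (x 𝔽.- y)) * α (φ (ι (x 𝔽.- y)) v w))

  -- The Kronecker delta of two encodings, with values in the ring so that the diagonal can be
  -- carried inside identities and sums.
  E : ∀ {d} → Monic d → Monic d → Carrier
  E []      []      = 1#
  E (x ∷ v) (y ∷ w) = choose (x 𝔽.≟ y) (E v w) 0#

  data Compare {d} (v w : Monic d) : Set (c ⊔ ℓ ⊔ b) where
    same  : v ≋ w → E v w ≈ 1# → D v w ≈ 0# → Compare v w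
    apart : E v w ≈ 0# → D v w * (T v - T w) ≈ X ^ d → Compare v w

  -≉0 : ∀ {x y} → ¬ (x 𝔽.≈ y) → ¬ (x 𝔽.- y 𝔽.≈ 𝔽.0#)
  -≉0 x≉y e = x≉y (𝔽′.x-y≈0⇒x≈y _ _ e)

  -≈0 : ∀ {x y} → x 𝔽.≈ y → x 𝔽.- y 𝔽.≈ 𝔽.0#
  -≈0 {x} {y} x≈y = 𝔽.trans (𝔽.+-congʳ x≈y) (𝔽.-‿inverseʳ y)

  choose-yes : ∀ {x y} {r s : Carrier} → x 𝔽.≈ y → choose (x 𝔽.≟ y) r s ≈ r
  choose-yes {x} {y} x≈y with x 𝔽.≟ y
  ... | yes _   = refl
  ... | no  x≉y = ⊥-elim (x≉y x≈y)

  choose-no : ∀ {x y} {r s : Carrier} → ¬ (x 𝔽.≈ y) → choose (x 𝔽.≟ y) r s ≈ s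
  choose-no {x} {y} x≉y with x 𝔽.≟ y
  ... | yes x≈y = ⊥-elim (x≉y x≈y)
  ... | no  _   = refl

  compare : ∀ {d} (v w : Monic d) → Compare v w
  compare []      []      = same [] refl refl
  compare {suc d} (x ∷ v) (y ∷ w) with x 𝔽.≟ y
  ... | yes x≈y with compare v w
  ...   | same v≋w e≈1 d≈0 = same (x≈y ∷ v≋w) (trans (choose-yes x≈y) e≈1) (trans (choose-yes x≈y) d≈0)
  ...   | apart e≈0 dt≈X = apart (trans (choose-yes x≈y) e≈0) (begin
      D (x ∷ v) (y ∷ w) * (T (x ∷ v) - T (y ∷ w))   ≈⟨ *-cong (choose-yes x≈y) (T-sub x y v w) ⟩
      D v w * (X * (C (x 𝔽.- y) + (T v - T w)))
        ≈⟨ *-congˡ (*-congˡ (+-congʳ (trans (C-cong (-≈0 x≈y)) C-0))) ⟩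
      D v w * (X * (0# + (T v - T w)))              ≈⟨ *-congˡ (*-congˡ (+-identityˡ _)) ⟩
      D v w * (X * (T v - T w))                     ≈⟨ x*yz≈y*xz _ _ _ ⟩
      X * (D v w * (T v - T w))                     ≈⟨ *-congˡ dt≈X ⟩
      X ^ suc d                                     ∎)
  -- At the first differing coefficient, scaling by `k` turns the bracket into `1# + T g`, which
  -- cancels against `V g`. The power `X ^ suc d` collects `X ^ d` from `α g` and one `X` from
  -- `T-sub`.
  compare {suc d} (x ∷ v) (y ∷ w) | no x≉y = apart (choose-no x≉y) (begin
      D (x ∷ v) (y ∷ w) * (T (x ∷ v) - T (y ∷ w))   ≈⟨ *-cong (choose-no x≉y) (T-sub x y v w) ⟩
      (C k * (X ^ d * V g)) * (X * (C (x 𝔽.- y) + (T v - T w)))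
        ≈⟨ solve 5 (λ k p v x t → (k :* (p :* v)) :* (x :* t) := (x :* p) :* ((k :* t) :* v)) refl
             (C k) (X ^ d) (V g) X (C (x 𝔽.- y) + (T v - T w)) ⟩
      (X * X ^ d) * ((C k * (C (x 𝔽.- y) + (T v - T w))) * V g)
        ≈⟨ *-congˡ (*-congʳ (distribˡ (C k) _ _)) ⟩
      (X * X ^ d) * ((C k * C (x 𝔽.- y) + C k * (T v - T w)) * V g)
        ≈⟨ *-congˡ (*-congʳ (+-cong Ck≈1 (sym (T-φ k v w)))) ⟩
      (X * X ^ d) * ((1# + T g) * V g)
        ≈⟨ *-congˡ (V-inverse g) ⟩
      (X * X ^ d) * 1#                              ≈⟨ *-identityʳ _ ⟩
      X ^ suc d                                     ∎)
    where
    open SemiringSolver commutativeSemiring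
    k : 𝔽.Carrier
    k = ι (x 𝔽.- y)
    g : Monic d
    g = φ k v w
    Ck≈1 : C k * C (x 𝔽.- y) ≈ 1#
    Ck≈1 = trans (sym (C-* _ _)) (trans (C-cong (𝔽.trans (𝔽.*-comm _ _) (*-ι (-≉0 x≉y)))) C-1)

  -- One of the two factors `X ^ d` is traded for `D v w * (T v - T w)`; the difference `T v - T w`
  -- then equals that of `1# + T v` and `1# + T w`, each of which cancels its inverse.
  α-relation : ∀ {d} (v w : Monic d) → D v w * (T v - T w) ≈ X ^ d →
               α v * α w ≈ D v w * (α w - α v)
  α-relation {d} v w dt≈X = begin
    (P * V v) * (P * V w)
      ≈⟨ *-congʳ (*-congʳ dt≈X) ⟨
    ((D v w * (T v - T w)) * V v) * (P * V w)
      ≈⟨ solve 5 (λ p d t v w → ((d :* t) :* v) :* (p :* w) := d :* (p :* ((v :* w) :* t))) refl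
           P (D v w) (T v - T w) (V v) (V w) ⟩
    D v w * (P * ((V v * V w) * (T v - T w)))
      ≈⟨ *-congˡ (*-congˡ V-sub) ⟩
    D v w * (P * (V w - V v))
      ≈⟨ *-congˡ (*-distribˡ-sub P (V w) (V v)) ⟩
    D v w * (α w - α v) ∎
    where
    open SemiringSolver commutativeSemiring
    P : Carrier
    P = X ^ d
    V-sub : (V v * V w) * (T v - T w) ≈ V w - V v
    V-sub = begin
      (V v * V w) * (T v - T w)
        ≈⟨ *-congˡ (trans (+-sub 1# _ 1# _) (trans (+-congʳ (-‿inverseʳ 1#)) (+-identityˡ _))) ⟨
      (V v * V w) * ((1# + T v) - (1# + T w))
        ≈⟨ *-distribˡ-sub _ _ _ ⟩
      (V v * V w) * (1# + T v) - (V v * V w) * (1# + T w)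
        ≈⟨ +-cong (solve 3 (λ v w t → (v :* w) :* t := w :* (t :* v)) refl (V v) (V w) (1# + T v))
                  (-‿cong (solve 3 (λ v w t → (v :* w) :* t := v :* (t :* w)) refl (V v) (V w) (1# + T w))) ⟩
      V w * ((1# + T v) * V v) - V v * ((1# + T w) * V w)
        ≈⟨ +-cong (trans (*-congˡ (V-inverse v)) (*-identityʳ _))
                  (-‿cong (trans (*-congˡ (V-inverse w)) (*-identityʳ _))) ⟩
      V w - V v ∎

  -- Here `g` is 1/(m - n), `G` a power of it, and `A`, `B` the remaining powers of 1/m and 1/n. In
  -- each resulting term one exponent falls by one and that of `g` rises by one, so the weight is
  -- preserved.
  partial-fraction : ∀ {x y g} G A B → x * y ≈ g * (y - x) →
    G * ((x * A) * (y * B)) ≈ (g * G) * (A * (y * B)) - (g * G) * ((x * A) * B)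
  partial-fraction {x} {y} {g} G A B xy≈ = begin
    G * ((x * A) * (y * B))        ≈⟨ *-congˡ (*-interchange x A y B) ⟩
    G * ((x * y) * (A * B))        ≈⟨ *-congˡ (*-congʳ xy≈) ⟩
    G * ((g * (y - x)) * (A * B))
      ≈⟨ solve 4 (λ G g d c → G :* ((g :* d) :* c) := ((g :* G) :* c) :* d) refl G g (y - x) (A * B) ⟩
    ((g * G) * (A * B)) * (y - x)  ≈⟨ *-distribˡ-sub _ y x ⟩
    ((g * G) * (A * B)) * y - ((g * G) * (A * B)) * x
      ≈⟨ +-cong (solve 4 (λ H a b y → (H :* (a :* b)) :* y := H :* (a :* (y :* b))) refl (g * G) A B y)
                (-‿cong (solve 4 (λ H a b x → (H :* (a :* b)) :* x := H :* ((x :* a) :* b)) refl (g * G) A B x)) ⟩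
    (g * G) * (A * (y * B)) - (g * G) * ((x * A) * B) ∎
    where open SemiringSolver commutativeSemiring

  term : ∀ {d} → ℕ → ℕ → ℕ → Monic d → Monic d → Carrier
  term j m n v w = D v w ^ j * (α v ^ m * α w ^ n)

  term-zero : ∀ {d} j m n (v w : Monic d) → D v w ≈ 0# → term (suc j) m n v w ≈ 0#
  term-zero j m n v w d≈0 = trans (*-congʳ (0^1+n≈0 j d≈0)) (zeroˡ _)

  -- On the diagonal all three terms vanish because `D` occurs with a positive exponent; hence the
  -- double sums may run over all pairs.
  term-step : ∀ {d} j m n (v w : Monic d) →
    term (suc j) (suc m) (suc n) v w
      ≈ term (suc (suc j)) m (suc n) v w - term (suc (suc j)) (suc m) n v w
  term-step j m n v w with compare v w
  ... | same _ _ d≈0   = trans (term-zero j (suc m) (suc n) v w d≈0)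
                           (sym (x≈0∧y≈0⇒x-y≈0 (term-zero (suc j) m (suc n) v w d≈0) (term-zero (suc j) (suc m) n v w d≈0)))
  ... | apart _ dt≈X   = partial-fraction _ _ _ (α-relation v w dt≈X)

  -- The initial step differs from `term-step` in that no power of `D` is present yet to kill the
  -- diagonal, which survives as the summand with `E`.
  α-product : ∀ {d} m n (v w : Monic d) →
    α v ^ suc m * α w ^ suc n
      ≈ E v w * (α v ^ suc m * α w ^ suc n) + (term 1 m (suc n) v w - term 1 (suc m) n v w)
  α-product m n v w with compare v w
  ... | same _ e≈1 d≈0 = sym (trans
          (+-cong (trans (*-congʳ e≈1) (*-identityˡ _))
                  (x≈0∧y≈0⇒x-y≈0 (term-zero 0 m (suc n) v w d≈0) (term-zero 0 (suc m) n v w d≈0)))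
          (+-identityʳ _))
  -- `1#` plays the part of `D v w ^ 0`, and `D v w * 1#` is `D v w ^ 1` by computation.
  ... | apart e≈0 dt≈X = trans (sym (*-identityˡ _)) (trans
          (partial-fraction 1# _ _ (α-relation v w dt≈X))
          (sym (trans (+-congʳ (trans (*-congʳ e≈0) (zeroˡ _))) (+-identityˡ _))))

  -- Power sums over monic polynomials and their products.

  ∑-monics : ∀ d (h : Monic (suc d) → Carrier) →
             ∑ (monics (suc d)) h ≈ ∑ 𝔽.elements (λ x → ∑ (monics d) (λ v → h (x ∷ v)))
  ∑-monics d h = trans (∑-concatMap (λ x → map (x ∷_) (monics d)) 𝔽.elements h)
                       (∑-cong 𝔽.elements (λ x → ∑-map (x ∷_) (monics d) h))

  ≋-refl : ∀ {d} {v : Monic d} → v ≋ v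
  ≋-refl = Pointwise.refl 𝔽.refl

  ∑-E : ∀ {d} (v : Monic d) (h : Monic d → Carrier) → (∀ {u w} → u ≋ w → h u ≈ h w) →
        ∑ (monics d) (λ w → E w v * h w) ≈ h v
  ∑-E []      h h-cong = trans (+-identityʳ _) (*-identityˡ _)
  ∑-E {suc d} (y ∷ v) h h-cong = begin
    ∑ (monics (suc d)) (λ w → E w (y ∷ v) * h w)
      ≈⟨ ∑-monics d _ ⟩
    ∑ 𝔽.elements (λ x → ∑ (monics d) (λ w → choose (x 𝔽.≟ y) (E w v) 0# * h (x ∷ w)))
      ≈⟨ ∑-cong 𝔽.elements inner ⟩
    ∑ 𝔽.elements (λ x → choose (x 𝔽.≟ y) (h (x ∷ v)) 0#)
      ≈⟨ ∑-pick y (λ x → h (x ∷ v)) (λ x≈z → h-cong (x≈z ∷ ≋-refl)) ⟩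
    h (y ∷ v) ∎
    where
    inner : ∀ x → ∑ (monics d) (λ w → choose (x 𝔽.≟ y) (E w v) 0# * h (x ∷ w))
                ≈ choose (x 𝔽.≟ y) (h (x ∷ v)) 0#
    inner x with x 𝔽.≟ y
    ... | yes _ = ∑-E v (λ w → h (x ∷ w)) (λ u≋w → h-cong (𝔽.refl ∷ u≋w))
    ... | no  _ = trans (∑-cong (monics d) (λ w → zeroˡ _)) (∑-zero (monics d))

  -- On each coordinate `φ` is an affine map with slope the unit `k`, hence a permutation of the
  -- field.
  ∑-φ : ∀ {d k} → ¬ (k 𝔽.≈ 𝔽.0#) → (w : Monic d) (h : Monic d → Carrier) →
        (∀ {u w} → u ≋ w → h u ≈ h w) → ∑ (monics d) (λ v → h (φ k v w)) ≈ ∑ (monics d) h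
  ∑-φ k≉0 []      h h-cong = refl
  ∑-φ {suc d} {k} k≉0 (y ∷ w) h h-cong = begin
    ∑ (monics (suc d)) (λ v → h (φ k v (y ∷ w)))
      ≈⟨ ∑-monics d _ ⟩
    ∑ 𝔽.elements (λ x → ∑ (monics d) (λ v → h (π x ∷ φ k v w)))
      ≈⟨ ∑-cong 𝔽.elements (λ x → ∑-φ k≉0 w (λ v → h (π x ∷ v)) (λ u≋w → h-cong (𝔽.refl ∷ u≋w))) ⟩
    ∑ 𝔽.elements (λ x → ∑ (monics d) (λ v → h (π x ∷ v)))
      ≈⟨ ∑-bijection π (λ x → ι k 𝔽.* x 𝔽.+ y) (λ e → 𝔽.*-congˡ (𝔽.+-congʳ e)) (λ e → 𝔽.+-congʳ (𝔽.*-congˡ e))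
           (λ x → 𝔽.trans (𝔽.*-congˡ (𝔽′.sub-cancel _ y)) (cancel (*-ι k≉0) x))
           (λ x → 𝔽.trans (𝔽.+-congʳ (cancel (𝔽.trans (𝔽.*-comm _ k) (*-ι k≉0)) _)) (𝔽′.sub-add x y))
           (λ x → ∑ (monics d) (λ v → h (x ∷ v)))
           (λ x≈z → ∑-cong (monics d) (λ v → h-cong (x≈z ∷ ≋-refl))) ⟩
    ∑ 𝔽.elements (λ x → ∑ (monics d) (λ v → h (x ∷ v)))
      ≈⟨ ∑-monics d h ⟨
    ∑ (monics (suc d)) h ∎
    where
    π : 𝔽.Carrier → 𝔽.Carrier
    π x = k 𝔽.* (x 𝔽.- y)

  S : ℕ → ℕ → Carrier
  S d s = ∑ (monics d) (λ v → α v ^ s)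

  S< : ℕ → ℕ → Carrier
  S< d s = σ d (λ e → S e s)

  -- If the first coefficients agree, the difference has smaller degree and falls under the
  -- induction hypothesis. If they differ, it has degree exactly `d` and leading coefficient
  -- `x - y`, and its monic part runs over all of `monics d`; this supplies the new layer `S d` of
  -- `S<`.
  ∑-D : ∀ {d} j (w : Monic d) →
        ∑ (monics d) (λ v → D v w ^ suc j) ≈ C (powerSum (suc j)) * S< d (suc j)
  ∑-D j [] = trans (+-identityʳ _) (trans (zeroˡ _) (sym (zeroʳ _)))
  ∑-D {suc d} j (y ∷ w) = begin
    ∑ (monics (suc d)) (λ v → D v (y ∷ w) ^ k)
      ≈⟨ ∑-monics d _ ⟩
    ∑ 𝔽.elements (λ x → ∑ (monics d) (λ v → D (x ∷ v) (y ∷ w) ^ k))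
      ≈⟨ ∑-cong 𝔽.elements inner ⟩
    ∑ 𝔽.elements (λ x → choose (x 𝔽.≟ y) L 0# + C (ι (x 𝔽.- y) 𝔽′.^ k) * S d k)
      ≈⟨ ∑-+ 𝔽.elements _ _ ⟩
    ∑ 𝔽.elements (λ x → choose (x 𝔽.≟ y) L 0#) + ∑ 𝔽.elements (λ x → C (ι (x 𝔽.- y) 𝔽′.^ k) * S d k)
      ≈⟨ +-cong (trans (∑-pick y (λ _ → L) (λ _ → refl)) (∑-D j w)) (sym (∑-* (S d k) 𝔽.elements _)) ⟩
    C (powerSum k) * S< d k + ∑ 𝔽.elements (λ x → C (ι (x 𝔽.- y) 𝔽′.^ k)) * S d k
      ≈⟨ +-congˡ (*-congʳ (trans (sym (C-∑ 𝔽.elements _))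
           (C-cong (∑-translate y (λ x → ι x 𝔽′.^ k) (λ e → 𝔽′.^-congˡ k (ι-cong e)))))) ⟩
    C (powerSum k) * S< d k + C (powerSum k) * S d k
      ≈⟨ distribˡ _ _ _ ⟨
    C (powerSum k) * S< (suc d) k ∎
    where
    k : ℕ
    k = suc j
    L : Carrier
    L = ∑ (monics d) (λ v → D v w ^ k)
    inner : ∀ x → ∑ (monics d) (λ v → D (x ∷ v) (y ∷ w) ^ k)
                ≈ choose (x 𝔽.≟ y) L 0# + C (ι (x 𝔽.- y) 𝔽′.^ k) * S d k
    inner x with x 𝔽.≟ y
    -- The value `ι 0 = 0` removes the second summand here, so summing it over all `x` gives exactly
    -- `powerSum`.
    ... | yes x≈y = sym (trans (+-congˡ (trans (*-congʳ Cι≈0) (zeroˡ _))) (+-identityʳ _))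
      where
      Cι≈0 : C (ι (x 𝔽.- y) 𝔽′.^ k) ≈ 0#
      Cι≈0 = trans (C-cong (𝔽′.0^1+n≈0 j (ι-zero (-≈0 x≈y)))) C-0
    ... | no  x≉y = begin
      ∑ (monics d) (λ v → (C u * α (φ u v w)) ^ k)
        ≈⟨ ∑-cong (monics d) (λ v → trans (^-distrib-* _ _ k) (*-congʳ (sym (C-^ u k)))) ⟩
      ∑ (monics d) (λ v → C (u 𝔽′.^ k) * α (φ u v w) ^ k)
        ≈⟨ *-∑ _ (monics d) _ ⟨
      C (u 𝔽′.^ k) * ∑ (monics d) (λ v → α (φ u v w) ^ k)
        ≈⟨ *-congˡ (∑-φ (ι≉0 (-≉0 x≉y)) w (λ v → α v ^ k) (λ e → ^-congˡ k (α-cong e))) ⟩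
      C (u 𝔽′.^ k) * S d k
        ≈⟨ +-identityˡ _ ⟨
      0# + C (u 𝔽′.^ k) * S d k ∎
      where
      u : 𝔽.Carrier
      u = ι (x 𝔽.- y)

  φ-antisym : ∀ {d k l} → k 𝔽.≈ 𝔽.- l → (v w : Monic d) → φ k v w ≋ φ l w v
  φ-antisym k≈-l []      []      = []
  φ-antisym {k = k} {l} k≈-l (x ∷ v) (y ∷ w) = eq ∷ φ-antisym k≈-l v w
    where
    eq : k 𝔽.* (x 𝔽.- y) 𝔽.≈ l 𝔽.* (y 𝔽.- x)
    eq = 𝔽.trans (𝔽.*-congʳ k≈-l) (𝔽.trans (𝔽.sym (𝔽′.-‿distribˡ-* l _))
           (𝔽.trans (𝔽′.-‿distribʳ-* l _) (𝔽.*-congˡ (𝔽′.-[x-y]≈y-x x y))))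

  D-antisym : ∀ {d} (v w : Monic d) → D v w ≈ - D w v
  D-antisym []      []      = sym -0#≈0#
  D-antisym (x ∷ v) (y ∷ w) with x 𝔽.≟ y | y 𝔽.≟ x
  ... | yes _   | yes _   = D-antisym v w
  ... | yes x≈y | no  y≉x = ⊥-elim (y≉x (𝔽.sym x≈y))
  ... | no  x≉y | yes y≈x = ⊥-elim (x≉y (𝔽.sym y≈x))
  ... | no  x≉y | no  y≉x = begin
    C k * α (φ k v w)     ≈⟨ *-cong (C-cong k≈-l) (α-cong (φ-antisym k≈-l v w)) ⟩
    C (𝔽.- l) * α (φ l w v) ≈⟨ *-congʳ (C-neg l) ⟩
    - C l * α (φ l w v)   ≈⟨ -‿distribˡ-* _ _ ⟨
    - (C l * α (φ l w v)) ∎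
    where
    k l : 𝔽.Carrier
    k = ι (x 𝔽.- y)
    l = ι (y 𝔽.- x)
    k≈-l : k 𝔽.≈ 𝔽.- l
    k≈-l = 𝔽.trans (ι-cong (𝔽.sym (𝔽′.-[x-y]≈y-x y x))) (ι-neg (-≉0 y≉x))

  B : ℕ → ℕ → ℕ → ℕ → Carrier
  B d j m n = ∑ (monics d) (λ v → ∑ (monics d) (λ w → term j m n v w))

  ∑∑-sub : ∀ d (f g : Monic d → Monic d → Carrier) →
    ∑ (monics d) (λ v → ∑ (monics d) (λ w → f v w - g v w))
      ≈ ∑ (monics d) (λ v → ∑ (monics d) (f v)) - ∑ (monics d) (λ v → ∑ (monics d) (g v))
  ∑∑-sub d f g = trans (∑-cong (monics d) (λ v → ∑-sub (monics d) (f v) (g v))) (∑-sub (monics d) _ _)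

  B-step : ∀ d j m n →
    B d (suc j) (suc m) (suc n) ≈ B d (suc (suc j)) m (suc n) - B d (suc (suc j)) (suc m) n
  B-step d j m n = trans (∑-cong (monics d) (λ v → ∑-cong (monics d) (λ w → term-step j m n v w)))
                         (∑∑-sub d _ _)

  -- With no power of `α v` left, the sum over `v` is that of `∑-D`, whose value does not depend on
  -- `w`.
  B-zeroˡ : ∀ d j n → B d (suc j) 0 n ≈ C (powerSum (suc j)) * (S d n * S< d (suc j))
  B-zeroˡ d j n = begin
    ∑ M (λ v → ∑ M (λ w → D v w ^ suc j * (1# * α w ^ n)))
      ≈⟨ ∑-swap M M _ ⟩
    ∑ M (λ w → ∑ M (λ v → D v w ^ suc j * (1# * α w ^ n)))
      ≈⟨ ∑-cong M (λ w → sym (∑-* _ M _)) ⟩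
    ∑ M (λ w → ∑ M (λ v → D v w ^ suc j) * (1# * α w ^ n))
      ≈⟨ ∑-cong M (λ w → *-cong (∑-D j w) (*-identityˡ _)) ⟩
    ∑ M (λ w → (C (powerSum (suc j)) * S< d (suc j)) * α w ^ n)
      ≈⟨ *-∑ _ M _ ⟨
    (C (powerSum (suc j)) * S< d (suc j)) * S d n
      ≈⟨ trans (*-assoc _ _ _) (*-congˡ (*-comm _ _)) ⟩
    C (powerSum (suc j)) * (S d n * S< d (suc j)) ∎
    where
    M : List (Monic d)
    M = monics d

  -- Exchanging the two polynomials reduces this to `B-zeroˡ`; each factor `D` changes sign, which
  -- accounts for the power of -1.
  B-zeroʳ : ∀ d j m →
    B d (suc j) m 0 ≈ C ((𝔽.- 𝔽.1#) 𝔽′.^ suc j 𝔽.* powerSum (suc j)) * (S d m * S< d (suc j))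
  B-zeroʳ d j m = begin
    B d k m 0
      ≈⟨ ∑-cong M (λ v → ∑-cong M (λ w → flip v w)) ⟩
    ∑ M (λ v → ∑ M (λ w → s * (D w v ^ k * (1# * α v ^ m))))
      ≈⟨ ∑-cong M (λ v → *-∑ s M _) ⟨
    ∑ M (λ v → s * ∑ M (λ w → D w v ^ k * (1# * α v ^ m)))
      ≈⟨ *-∑ s M _ ⟨
    s * ∑ M (λ v → ∑ M (λ w → D w v ^ k * (1# * α v ^ m)))
      ≈⟨ *-congˡ (∑-swap M M _) ⟩
    s * B d k 0 m
      ≈⟨ *-congˡ (B-zeroˡ d j m) ⟩
    s * (C (powerSum k) * (S d m * S< d k))
      ≈⟨ *-assoc _ _ _ ⟨
    (s * C (powerSum k)) * (S d m * S< d k)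
      ≈⟨ *-congʳ (C-* _ _) ⟨
    C ((𝔽.- 𝔽.1#) 𝔽′.^ k 𝔽.* powerSum k) * (S d m * S< d k) ∎
    where
    k : ℕ
    k = suc j
    M : List (Monic d)
    M = monics d
    s : Carrier
    s = C ((𝔽.- 𝔽.1#) 𝔽′.^ k)
    C-1*x : ∀ x → C (𝔽.- 𝔽.1#) * x ≈ - x
    C-1*x x = trans (*-congʳ (trans (C-neg _) (-‿cong C-1))) (-1*x≈-x x)
    flip : ∀ v w → term k m 0 v w ≈ s * (D w v ^ k * (1# * α v ^ m))
    flip v w = begin
      D v w ^ k * (α v ^ m * 1#)
        ≈⟨ *-cong (^-congˡ k (trans (D-antisym v w) (sym (C-1*x _)))) (*-comm _ _) ⟩
      (C (𝔽.- 𝔽.1#) * D w v) ^ k * (1# * α v ^ m)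
        ≈⟨ *-congʳ (trans (^-distrib-* _ _ k) (*-congʳ (sym (C-^ _ k)))) ⟩
      (s * D w v ^ k) * (1# * α v ^ m)
        ≈⟨ *-assoc _ _ _ ⟩
      s * (D w v ^ k * (1# * α v ^ m)) ∎

  S-product : ∀ d m n → S d (suc m) * S d (suc n)
            ≈ S d (suc m ℕ.+ suc n) + (B d 1 m (suc n) - B d 1 (suc m) n)
  S-product d m n = begin
    S d (suc m) * S d (suc n)
      ≈⟨ ∑-* _ M _ ⟩
    ∑ M (λ v → α v ^ suc m * S d (suc n))
      ≈⟨ ∑-cong M (λ v → *-∑ _ M _) ⟩
    ∑ M (λ v → ∑ M (λ w → α v ^ suc m * α w ^ suc n))
      ≈⟨ ∑-cong M (λ v → trans (∑-cong M (λ w → α-product m n v w)) (∑-+ M _ _)) ⟩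
    ∑ M (λ v → ∑ M (λ w → E v w * (α v ^ suc m * α w ^ suc n))
             + ∑ M (λ w → term 1 m (suc n) v w - term 1 (suc m) n v w))
      ≈⟨ ∑-+ M _ _ ⟩
    ∑ M (λ v → ∑ M (λ w → E v w * (α v ^ suc m * α w ^ suc n)))
      + ∑ M (λ v → ∑ M (λ w → term 1 m (suc n) v w - term 1 (suc m) n v w))
      ≈⟨ +-cong diagonal (∑∑-sub d _ _) ⟩
    S d (suc m ℕ.+ suc n) + (B d 1 m (suc n) - B d 1 (suc m) n) ∎
    where
    M : List (Monic d)
    M = monics d
    diagonal : ∑ M (λ v → ∑ M (λ w → E v w * (α v ^ suc m * α w ^ suc n))) ≈ S d (suc m ℕ.+ suc n)
    diagonal = begin
      ∑ M (λ v → ∑ M (λ w → E v w * (α v ^ suc m * α w ^ suc n)))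
        ≈⟨ ∑-swap M M _ ⟩
      ∑ M (λ w → ∑ M (λ v → E v w * (α v ^ suc m * α w ^ suc n)))
        ≈⟨ ∑-cong M (λ w → ∑-E w (λ v → α v ^ suc m * α w ^ suc n)
             (λ e → *-congʳ (^-congˡ (suc m) (α-cong e)))) ⟩
      ∑ M (λ w → α w ^ suc m * α w ^ suc n)
        ≈⟨ ∑-cong M (λ w → ^-homo-* (α w) (suc m) (suc n)) ⟨
      S d (suc m ℕ.+ suc n) ∎

  -- Products of truncated multizeta values.

  Word : Set c
  Word = List (ℕ × 𝔽.Carrier)

  K : ℕ → ℕ → 𝔽.Carrier → Carrier
  K d s e = C (e 𝔽′.^ d) * S d s

  -- The truncated value with the sum over monic polynomials of degree `d` already gathered in `K`;
  -- `Z≈Z` identifies it with the sum in the statement.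
  Z : ℕ → Word → Carrier
  Z N []            = 1#
  Z N ((s , e) ∷ w) = σ N (λ d → K d s e * Z d w)

  weight : Word → ℕ
  weight []            = 0
  weight ((s , _) ∷ w) = s ℕ.+ weight w

  twist : Word → 𝔽.Carrier
  twist []            = 𝔽.1#
  twist ((_ , e) ∷ w) = e 𝔽.* twist w

  Valid : Word → Set (c ⊔ ℓ)
  Valid = All (λ t → (1 ≤ proj₁ t) × ¬ (proj₂ t 𝔽.≈ 𝔽.0#))

  -- Length is only bounded because letters of equal degree can merge, whereas weight and product of
  -- twists are conserved exactly.
  record Admissible (n : ℕ) (p : 𝔽.Carrier) (l : ℕ) (w : Word) : Set (c ⊔ ℓ) where
    constructor admissible
    field
      valid    : Valid w
      length≤  : length w ≤ l
      weight≡  : weight w ≡ n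
      twist≈   : twist w 𝔽.≈ p

  -- G N is an 𝔽ₚ-linear combination, independent of N, of the Z N w with w admissible.
  data Combination (n : ℕ) (p : 𝔽.Carrier) (l : ℕ) (G : ℕ → Carrier) : Set (c ⊔ ℓ ⊔ a ⊔ b) where
    nil  : (∀ N → G N ≈ 0#) → Combination n p l G
    cons : ∀ f w (H : ℕ → Carrier) → Admissible n p l w → Combination n p l H →
           (∀ N → G N ≈ C (fromℕ f) * Z N w + H N) → Combination n p l G

  module _ {n : ℕ} {p : 𝔽.Carrier} {l : ℕ} where

    comb-resp : ∀ {G H} → (∀ N → G N ≈ H N) → Combination n p l H → Combination n p l G
    comb-resp G≈H (nil H≈0)               = nil (λ N → trans (G≈H N) (H≈0 N))
    comb-resp G≈H (cons f w H′ adm h H≈) = cons f w H′ adm h (λ N → trans (G≈H N) (H≈ N))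

    comb-word : ∀ {w} → Admissible n p l w → Combination n p l (λ N → Z N w)
    comb-word {w} adm = cons 1 w (λ _ → 0#) adm (nil (λ _ → refl)) (λ N → sym (begin
      C (𝔽.1# 𝔽.+ 𝔽.0#) * Z N w + 0#  ≈⟨ +-identityʳ _ ⟩
      C (𝔽.1# 𝔽.+ 𝔽.0#) * Z N w       ≈⟨ *-congʳ (trans (C-cong (𝔽.+-identityʳ _)) C-1) ⟩
      1# * Z N w                      ≈⟨ *-identityˡ _ ⟩
      Z N w                           ∎))

    comb-+ : ∀ {G H} → Combination n p l G → Combination n p l H →
             Combination n p l (λ N → G N + H N)
    comb-+ (nil G≈0)              h = comb-resp (λ N → trans (+-congʳ (G≈0 N)) (+-identityˡ _)) h
    comb-+ (cons f w G′ adm g G≈) h =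
      cons f w _ adm (comb-+ g h) (λ N → trans (+-congʳ (G≈ N)) (+-assoc _ _ _))

    comb-scale : ∀ {G x} → 𝔽ₚ x → Combination n p l G → Combination n p l (λ N → C x * G N)
    comb-scale {x = x} x∈𝔽ₚ (nil G≈0) = nil (λ N → trans (*-congˡ (G≈0 N)) (zeroʳ _))
    comb-scale {G} {x} (m , m≈x) (cons f w H adm h G≈) =
      cons (m ℕ.* f) w _ adm (comb-scale (m , m≈x) h) (λ N → begin
        C x * G N                               ≈⟨ *-congˡ (G≈ N) ⟩
        C x * (C (fromℕ f) * Z N w + H N)       ≈⟨ distribˡ _ _ _ ⟩
        C x * (C (fromℕ f) * Z N w) + C x * H N ≈⟨ +-congʳ (*-assoc _ _ _) ⟨
        C x * C (fromℕ f) * Z N w + C x * H N   ≈⟨ +-congʳ (*-congʳ (trans (C-cong coefficient) (C-* _ _))) ⟨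
        C (fromℕ (m ℕ.* f)) * Z N w + C x * H N ∎)
      where
      coefficient : fromℕ (m ℕ.* f) 𝔽.≈ x 𝔽.* fromℕ f
      coefficient = 𝔽.trans (fromℕ-* m f) (𝔽.*-congʳ m≈x)

    comb-neg : ∀ {G} → Combination n p l G → Combination n p l (λ N → - G N)
    comb-neg g = comb-resp (λ N → sym (trans (*-congʳ (trans (C-neg _) (-‿cong C-1))) (-1*x≈-x _)))
                           (comb-scale 𝔽ₚ--1 g)

    comb-weaken : ∀ {n′ p′ l′ G} → n ≡ n′ → p 𝔽.≈ p′ → l ≤ l′ →
                  Combination n p l G → Combination n′ p′ l′ G
    comb-weaken n≡ p≈ l≤ (nil G≈0) = nil G≈0
    comb-weaken n≡ p≈ l≤ (cons f w H (admissible v k≤ w≡ t≈) h G≈) =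
      cons f w H (admissible v (≤-trans k≤ l≤) (≡.trans w≡ n≡) (𝔽.trans t≈ p≈)) (comb-weaken n≡ p≈ l≤ h) G≈

    -- The expansion of `G` is inserted at every `d < N` under the sum; its coefficients can be
    -- pulled out because they are the same for all `d`.
    comb-head : ∀ {s e G} → 1 ≤ s → ¬ (e 𝔽.≈ 𝔽.0#) → Combination n p l G →
                Combination (s ℕ.+ n) (e 𝔽.* p) (suc l) (λ N → σ N (λ d → K d s e * G d))
    comb-head s≥1 e≉0 (nil G≈0) =
      nil (λ N → trans (σ-cong N (λ d → trans (*-congˡ (G≈0 d)) (zeroʳ _))) (σ-zero N))
    comb-head {s} {e} {G} s≥1 e≉0 (cons f w H (admissible v k≤ w≡ t≈) h G≈) =
      cons f ((s , e) ∷ w) _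
        (admissible ((s≥1 , e≉0) ∷ v) (s≤s k≤) (≡.cong (s ℕ.+_) w≡) (𝔽.*-congˡ t≈))
        (comb-head s≥1 e≉0 h) (λ N → begin
          σ N (λ d → K d s e * G d)
            ≈⟨ σ-cong N (λ d → trans (*-congˡ (G≈ d)) (trans (distribˡ _ _ _) (+-congʳ (x*yz≈y*xz _ _ _)))) ⟩
          σ N (λ d → C (fromℕ f) * (K d s e * Z d w) + K d s e * H d)
            ≈⟨ σ-+ N _ _ ⟩
          σ N (λ d → C (fromℕ f) * (K d s e * Z d w)) + σ N (λ d → K d s e * H d)
            ≈⟨ +-congʳ (*-σ _ N _) ⟨
          C (fromℕ f) * Z N ((s , e) ∷ w) + σ N (λ d → K d s e * H d) ∎)

  -- Linearity in the second factor reduces a product with a combination to products with single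
  -- words.
  comb-* : ∀ {n p l n′ p′ l′ G} {H : ℕ → Carrier} →
           (∀ {w} → Admissible n p l w → Combination n′ p′ l′ (λ N → H N * Z N w)) →
           Combination n p l G → Combination n′ p′ l′ (λ N → H N * G N)
  comb-* words (nil G≈0) = nil (λ N → trans (*-congˡ (G≈0 N)) (zeroʳ _))
  comb-* words (cons f w G′ adm g G≈) =
    comb-resp (λ N → trans (*-congˡ (G≈ N)) (trans (distribˡ _ _ _) (+-congʳ (x*yz≈y*xz _ _ _))))
              (comb-+ (comb-scale (f , 𝔽.refl) (words adm)) (comb-* words g))

  module _ {n : ℕ} {p : 𝔽.Carrier} {l : ℕ} {e : 𝔽.Carrier} {G : ℕ → Carrier} (e≉0 : ¬ (e 𝔽.≈ 𝔽.0#))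
           (tails : ∀ j → Combination (suc j ℕ.+ n) p l (λ d → S< d (suc j) * G d)) where

    private
      -- The end of the partial fraction recursion: `S d s` becomes the new leading letter with
      -- twist `e`, while `S< d (suc j)` is absorbed into the rest by `tails`.
      edge : ∀ j s {x} (b : ℕ → Carrier) → 1 ≤ s → 𝔽ₚ x →
             (∀ d → b d ≈ C x * (S d s * S< d (suc j))) →
             Combination (s ℕ.+ (suc j ℕ.+ n)) (e 𝔽.* p) (suc l) (λ N → σ N (λ d → C (e 𝔽′.^ d) * (b d * G d)))
      edge j s {x} b s≥1 x∈𝔽ₚ b≈ = comb-resp (λ N → begin
        σ N (λ d → C (e 𝔽′.^ d) * (b d * G d))
          ≈⟨ σ-cong N (λ d → trans (*-congˡ (*-congʳ (b≈ d)))
               (solve 5 (λ c x s t g → c :* ((x :* (s :* t)) :* g) := x :* ((c :* s) :* (t :* g))) refl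
                 (C (e 𝔽′.^ d)) (C x) (S d s) (S< d (suc j)) (G d))) ⟩
        σ N (λ d → C x * (K d s e * (S< d (suc j) * G d)))
          ≈⟨ *-σ _ N _ ⟨
        C x * σ N (λ d → K d s e * (S< d (suc j) * G d)) ∎)
        (comb-scale x∈𝔽ₚ (comb-head s≥1 e≉0 (tails j)))
        where open SemiringSolver commutativeSemiring

    -- Each step moves one unit from `m` or `k` to the exponent of `D`. The premise ensures that
    -- when one of the two reaches 0 the other is positive, as an exponent in a word must be.
    comb-B : ∀ j m k → 1 ≤ m ℕ.+ k →
             Combination (suc j ℕ.+ (m ℕ.+ k) ℕ.+ n) (e 𝔽.* p) (suc l)
               (λ N → σ N (λ d → C (e 𝔽′.^ d) * (B d (suc j) m k * G d)))
    comb-B j zero k k≥1 =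
      comb-weaken
        (ℕS.solve 3 (λ j k n → k ℕS.:+ (j ℕS.:+ n) ℕS.:= j ℕS.:+ k ℕS.:+ n) ≡.refl (suc j) k n)
        𝔽.refl ≤-refl
        (edge j k _ k≥1 (𝔽ₚ-powerSum j) (λ d → B-zeroˡ d j k))
    comb-B j (suc m) zero m≥1 =
      comb-weaken
        (ℕS.solve 3 (λ j k n → k ℕS.:+ (j ℕS.:+ n) ℕS.:= j ℕS.:+ (k ℕS.:+ ℕS.con 0) ℕS.:+ n)
          ≡.refl (suc j) (suc m) n)
        𝔽.refl ≤-refl
        (edge j (suc m) _ (s≤s z≤n) (𝔽ₚ-* (𝔽ₚ-^ (suc j) 𝔽ₚ--1) (𝔽ₚ-powerSum j)) (λ d → B-zeroʳ d j (suc m)))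
    comb-B j (suc m) (suc k) _ =
      comb-resp (λ N → begin
        σ N (λ d → C (e 𝔽′.^ d) * (B d (suc j) (suc m) (suc k) * G d))
          ≈⟨ σ-cong N (λ d → trans (*-congˡ (trans (*-congʳ (B-step d j m k)) (*-distribʳ-sub _ _ _)))
               (*-distribˡ-sub _ _ _)) ⟩
        σ N (λ d → P d - Q d)
          ≈⟨ trans (σ-+ N P _) (+-congˡ (σ-neg N Q)) ⟩
        σ N P - σ N Q ∎)
        (comb-+ (comb-weaken (≡.cong (λ t → suc (t ℕ.+ n)) (≡.sym (+-suc j (m ℕ.+ suc k)))) 𝔽.refl ≤-refl
                  (comb-B (suc j) m (suc k) (≤-trans (s≤s z≤n) (m≤n+m (suc k) m))))
                (comb-neg (comb-weaken
                  (≡.cong (λ t → suc (t ℕ.+ n))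
                    (≡.trans (≡.sym (+-suc j (suc m ℕ.+ k))) (≡.cong (λ t → j ℕ.+ suc t) (≡.sym (+-suc m k)))))
                  𝔽.refl ≤-refl (comb-B (suc j) (suc m) k (s≤s z≤n)))))
      where
      P Q : ℕ → Carrier
      P d = C (e 𝔽′.^ d) * (B d (suc (suc j)) m (suc k) * G d)
      Q d = C (e 𝔽′.^ d) * (B d (suc (suc j)) (suc m) k * G d)

  -- Twist 1 lets the extra factor become a letter without changing the product of the twists.
  Z-singleton : ∀ d s → Z d ((s , 𝔽.1#) ∷ []) ≈ S< d s
  Z-singleton d s = σ-cong d (λ e → trans (*-identityʳ _)
    (trans (*-congʳ (trans (C-cong (𝔽′.1^n≈1 e)) C-1)) (*-identityˡ _)))

  -- Equal degrees let the twists merge, as e^d f^d = (ef)^d, and `S-product` then treats the two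
  -- power sums of degree `d`.
  comb-diagonal : ∀ {m k e f n p l G} → 1 ≤ m → 1 ≤ k → ¬ (e 𝔽.≈ 𝔽.0#) → ¬ (f 𝔽.≈ 𝔽.0#) →
    Combination n p l G →
    (∀ j → Combination (suc j ℕ.+ n) p (suc l) (λ d → S< d (suc j) * G d)) →
    Combination (m ℕ.+ k ℕ.+ n) ((e 𝔽.* f) 𝔽.* p) (suc (suc l)) (λ N → σ N (λ d → (K d m e * K d k f) * G d))
  comb-diagonal {suc m} {suc k} {e} {f} {n} {p} {l} {G} _ _ e≉0 f≉0 g tails = comb-resp (λ N → begin
    σ N (λ d → (K d (suc m) e * K d (suc k) f) * G d)
      ≈⟨ σ-cong N expand ⟩
    σ N (λ d → K d (suc m ℕ.+ suc k) ef * G d + (P d - Q d))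
      ≈⟨ trans (σ-+ N _ _) (+-congˡ (trans (σ-+ N P _) (+-congˡ (σ-neg N Q)))) ⟩
    σ N (λ d → K d (suc m ℕ.+ suc k) ef * G d) + (σ N P - σ N Q) ∎)
    -- The merged letter of exponent `suc m + suc k` stays one below the depth bound; only terms
    -- with an additional letter can attain it.
    (comb-+ (comb-weaken ≡.refl 𝔽.refl (n≤1+n _) (comb-head (s≤s z≤n) ef≉0 g))
      (comb-+ (comb-B ef≉0 tails 0 m (suc k) (≤-trans (s≤s z≤n) (m≤n+m (suc k) m)))
              (comb-neg (comb-weaken (≡.cong (λ t → suc t ℕ.+ n) (≡.sym (+-suc m k))) 𝔽.refl ≤-refl
                 (comb-B ef≉0 tails 0 (suc m) k (s≤s z≤n))))))
    where
    open SemiringSolver commutativeSemiring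
    ef : 𝔽.Carrier
    ef = e 𝔽.* f
    ef≉0 : ¬ (ef 𝔽.≈ 𝔽.0#)
    ef≉0 = *≉0 e≉0 f≉0
    P Q : ℕ → Carrier
    P d = C (ef 𝔽′.^ d) * (B d 1 m (suc k) * G d)
    Q d = C (ef 𝔽′.^ d) * (B d 1 (suc m) k * G d)
    expand : ∀ d → (K d (suc m) e * K d (suc k) f) * G d
                 ≈ K d (suc m ℕ.+ suc k) ef * G d + (P d - Q d)
    expand d = begin
      (K d (suc m) e * K d (suc k) f) * G d
        ≈⟨ *-congʳ (*-interchange _ _ _ _) ⟩
      ((C (e 𝔽′.^ d) * C (f 𝔽′.^ d)) * (S d (suc m) * S d (suc k))) * G d
        ≈⟨ *-congʳ (*-cong (trans (sym (C-* _ _)) (C-cong (𝔽.sym (𝔽′.^-distrib-* e f d)))) (S-product d m k)) ⟩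
      (z * (s + (u - v))) * G d
        ≈⟨ solve 4 (λ c s t g → (c :* (s :+ t)) :* g := (c :* s) :* g :+ c :* (t :* g)) refl z s (u - v) (G d) ⟩
      (z * s) * G d + z * ((u - v) * G d)
        ≈⟨ +-congˡ (trans (*-congˡ (*-distribʳ-sub _ _ _)) (*-distribˡ-sub _ _ _)) ⟩
      (z * s) * G d + (P d - Q d) ∎
      where
      z s u v : Carrier
      z = C (ef 𝔽′.^ d)
      s = S d (suc m ℕ.+ suc k)
      u = B d 1 m (suc k)
      v = B d 1 (suc m) k

  -- Induction on a bound D for the total depth: the case d = e removes both leading letters but
  -- may create a new depth-one factor S< d j, which is still one letter fewer.
  comb-product : ∀ D u w → length u ℕ.+ length w ≤ D → Valid u → Valid w →
    Combination (weight u ℕ.+ weight w) (twist u 𝔽.* twist w) (length u ℕ.+ length w) (λ N → Z N u * Z N w)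
  comb-product D [] w _ _ w-valid =
    comb-resp (λ N → *-identityˡ _) (comb-word (admissible w-valid ≤-refl ≡.refl (𝔽.sym (𝔽.*-identityˡ _))))
  comb-product D u@(_ ∷ _) [] _ u-valid _ =
    comb-resp (λ N → *-identityʳ _)
      (comb-word (admissible u-valid (m≤m+n _ 0) (≡.sym (ℕₚ.+-identityʳ _)) (𝔽.sym (𝔽.*-identityʳ _))))
  comb-product (suc D) ((m , e) ∷ u) ((k , f) ∷ w) (s≤s depth) ((m≥1 , e≉0) ∷ u-valid) ((k≥1 , f≉0) ∷ w-valid) =
    comb-resp (λ N → trans (σ-* N _ _) (+-cong (+-cong
                (σ-cong N (λ d → *-assoc _ _ _))
                (σ-cong N (λ d → trans (*-assoc _ _ _) (*-congˡ (*-comm _ _)))))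
                (σ-cong N (λ d → *-interchange _ _ _ _))))
      (comb-+ (comb-+
        (comb-weaken (≡.sym (ℕₚ.+-assoc m _ _)) (𝔽.sym (𝔽.*-assoc _ _ _)) ≤-refl
          (comb-head m≥1 e≉0 (comb-product D u ((k , f) ∷ w) depth u-valid ((k≥1 , f≉0) ∷ w-valid))))
        (comb-weaken (ℕ+.x∙yz≈y∙xz k (m ℕ.+ weight u) (weight w)) (𝔽′.x*yz≈y*xz f _ _) (≤-reflexive (≡.cong suc (≡.sym (+-suc _ _))))
          (comb-head k≥1 f≉0 (comb-product D ((m , e) ∷ u) w (≤-trans (≤-reflexive (≡.sym (+-suc _ _))) depth)
            ((m≥1 , e≉0) ∷ u-valid) w-valid))))
        (comb-weaken (ℕ+.interchange m k _ _) (𝔽′.*-interchange e f _ _) (≤-reflexive (≡.cong suc (≡.sym (+-suc _ _))))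
          (comb-diagonal m≥1 k≥1 e≉0 f≉0 (comb-product D u w (≤-trans (n≤1+n _) depth′) u-valid w-valid) tails)))
    where
    depth′ : suc (length u ℕ.+ length w) ≤ D
    depth′ = ≤-trans (≤-reflexive (≡.sym (+-suc _ _))) depth
    -- The induction is used twice: on the tails, and then on the new letter with each resulting
    -- word `v`. The second pair has total depth one less than the original; since `v` is not a part
    -- of `u` or `w`, a numerical bound carries the recursion.
    tails : ∀ j → Combination (suc j ℕ.+ (weight u ℕ.+ weight w)) (twist u 𝔽.* twist w) (suc (length u ℕ.+ length w))
                    (λ d → S< d (suc j) * (Z d u * Z d w))
    tails j = comb-* singleton (comb-product D u w (≤-trans (n≤1+n _) depth′) u-valid w-valid)
      where
      singleton : ∀ {v} → Admissible (weight u ℕ.+ weight w) (twist u 𝔽.* twist w) (length u ℕ.+ length w) v →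
        Combination (suc j ℕ.+ (weight u ℕ.+ weight w)) (twist u 𝔽.* twist w) (suc (length u ℕ.+ length w))
          (λ d → S< d (suc j) * Z d v)
      singleton {v} (admissible v-valid length≤ weight≡ twist≈) =
        comb-resp (λ d → *-congʳ (sym (Z-singleton d (suc j))))
          (comb-weaken (≡.cong₂ ℕ._+_ (ℕₚ.+-identityʳ (suc j)) weight≡)
            (𝔽.trans (𝔽.*-congʳ (𝔽.*-identityˡ _)) (𝔽.trans (𝔽.*-identityˡ _) twist≈)) (s≤s length≤)
            (comb-product D ((suc j , 𝔽.1#) ∷ []) v (≤-trans (s≤s length≤) depth′)
              ((s≤s z≤n , 𝔽.1≉0) ∷ []) v-valid))

-- The ring of formal power series in 1/θ.

module PowerSeries {c ℓ} (F : FiniteField c ℓ) where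
  open FiniteField F
  open Zeta F
  open RingFacts commRing using (+-interchange)
  open import Relation.Binary.Reasoning.Setoid setoid

  tail : PS → PS
  tail f n = f (suc n)

  *PS-zero : ∀ f g → (f *PS g) 0 ≈ f 0 * g 0
  *PS-zero f g = +-identityʳ _

  -- The Cauchy product under the splitting of `f` into constant term and shifted tail. The ring
  -- laws follow from it by induction on the index of the coefficient, without rearranging double
  -- sums.
  *PS-suc : ∀ f g n → (f *PS g) (suc n) ≈ f 0 * g (suc n) + (tail f *PS g) n
  *PS-suc f g n = +-congˡ (reflexive (≡.cong Σl (≡.trans (map-applyUpTo suc h (suc n))
                                                   (≡.sym (map-upTo (λ k → h (suc k)) (suc n))))))
    where
    h : ℕ → Carrier
    h k = f k * g (suc n ℕ.∸ k)

  *PS-sucʳ : ∀ f g n → (f *PS g) (suc n) ≈ f (suc n) * g 0 + (f *PS tail g) n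
  *PS-sucʳ f g zero = begin
    (f *PS g) 1                       ≈⟨ *PS-suc f g 0 ⟩
    f 0 * g 1 + (tail f *PS g) 0      ≈⟨ +-cong (sym (*PS-zero f (tail g))) (*PS-zero (tail f) g) ⟩
    (f *PS tail g) 0 + f 1 * g 0      ≈⟨ +-comm _ _ ⟩
    f 1 * g 0 + (f *PS tail g) 0      ∎
  *PS-sucʳ f g (suc n) = begin
    (f *PS g) (2 ℕ.+ n)                                                          ≈⟨ *PS-suc f g (suc n) ⟩
    f 0 * g (2 ℕ.+ n) + (tail f *PS g) (suc n)                                   ≈⟨ +-congˡ (*PS-sucʳ (tail f) g n) ⟩
    f 0 * g (2 ℕ.+ n) + (f (2 ℕ.+ n) * g 0 + (tail f *PS tail g) n)              ≈⟨ +-assoc _ _ _ ⟨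
    (f 0 * g (2 ℕ.+ n) + f (2 ℕ.+ n) * g 0) + (tail f *PS tail g) n              ≈⟨ +-congʳ (+-comm _ _) ⟩
    (f (2 ℕ.+ n) * g 0 + f 0 * g (2 ℕ.+ n)) + (tail f *PS tail g) n              ≈⟨ +-assoc _ _ _ ⟩
    f (2 ℕ.+ n) * g 0 + (f 0 * g (2 ℕ.+ n) + (tail f *PS tail g) n)              ≈⟨ +-congˡ (*PS-suc f (tail g) n) ⟨
    f (2 ℕ.+ n) * g 0 + (f *PS tail g) (suc n)                                   ∎

  -- Agreement up to `n` suffices for coefficient `n`; this is what permits truncating both factors
  -- of a product of multizeta values.
  *PS-local : ∀ {f f′ g g′} n → (∀ k → k ≤ n → f k ≈ f′ k) → (∀ k → k ≤ n → g k ≈ g′ k) →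
              (f *PS g) n ≈ (f′ *PS g′) n
  *PS-local {f} {f′} {g} {g′} zero f≈ g≈ = +-congʳ (*-cong (f≈ 0 z≤n) (g≈ 0 z≤n))
  *PS-local {f} {f′} {g} {g′} (suc n) f≈ g≈ = begin
    (f *PS g) (suc n)                          ≈⟨ *PS-suc f g n ⟩
    f 0 * g (suc n) + (tail f *PS g) n         ≈⟨ +-cong (*-cong (f≈ 0 z≤n) (g≈ (suc n) ≤-refl))
                                                    (*PS-local n (λ k k≤n → f≈ (suc k) (s≤s k≤n))
                                                                 (λ k k≤n → g≈ k (≤-trans k≤n (n≤1+n n)))) ⟩
    f′ 0 * g′ (suc n) + (tail f′ *PS g′) n     ≈⟨ *PS-suc f′ g′ n ⟨
    (f′ *PS g′) (suc n)                        ∎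

  *PS-cong : ∀ {f f′ g g′} → f ≈PS f′ → g ≈PS g′ → (f *PS g) ≈PS (f′ *PS g′)
  *PS-cong f≈ g≈ n = *PS-local n (λ k _ → f≈ k) (λ k _ → g≈ k)

  *PS-comm : ∀ f g → (f *PS g) ≈PS (g *PS f)
  *PS-comm f g zero    = +-congʳ (*-comm _ _)
  *PS-comm f g (suc n) = begin
    (f *PS g) (suc n)                    ≈⟨ *PS-suc f g n ⟩
    f 0 * g (suc n) + (tail f *PS g) n   ≈⟨ +-cong (*-comm _ _) (*PS-comm (tail f) g n) ⟩
    g (suc n) * f 0 + (g *PS tail f) n   ≈⟨ *PS-sucʳ g f n ⟨
    (g *PS f) (suc n)                    ∎

  *PS-distribʳ : ∀ h f g → ((f +PS g) *PS h) ≈PS ((f *PS h) +PS (g *PS h))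
  *PS-distribʳ h f g zero = begin
    ((f +PS g) *PS h) 0            ≈⟨ *PS-zero (f +PS g) h ⟩
    (f 0 + g 0) * h 0              ≈⟨ distribʳ _ _ _ ⟩
    f 0 * h 0 + g 0 * h 0          ≈⟨ +-cong (*PS-zero f h) (*PS-zero g h) ⟨
    (f *PS h) 0 + (g *PS h) 0      ∎
  *PS-distribʳ h f g (suc n) = begin
    ((f +PS g) *PS h) (suc n)
      ≈⟨ *PS-suc (f +PS g) h n ⟩
    (f 0 + g 0) * h (suc n) + ((tail f +PS tail g) *PS h) n
      ≈⟨ +-cong (distribʳ _ _ _) (*PS-distribʳ h (tail f) (tail g) n) ⟩
    (f 0 * h (suc n) + g 0 * h (suc n)) + ((tail f *PS h) n + (tail g *PS h) n)
      ≈⟨ +-interchange _ _ _ _ ⟩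
    (f 0 * h (suc n) + (tail f *PS h) n) + (g 0 * h (suc n) + (tail g *PS h) n)
      ≈⟨ +-cong (*PS-suc f h n) (*PS-suc g h n) ⟨
    (f *PS h) (suc n) + (g *PS h) (suc n) ∎

  scalePS-* : ∀ a f g → (scalePS a f *PS g) ≈PS scalePS a (f *PS g)
  scalePS-* a f g zero = begin
    (scalePS a f *PS g) 0  ≈⟨ *PS-zero (scalePS a f) g ⟩
    (a * f 0) * g 0        ≈⟨ *-assoc _ _ _ ⟩
    a * (f 0 * g 0)        ≈⟨ *-congˡ (*PS-zero f g) ⟨
    a * (f *PS g) 0        ∎
  scalePS-* a f g (suc n) = begin
    (scalePS a f *PS g) (suc n)                              ≈⟨ *PS-suc (scalePS a f) g n ⟩
    (a * f 0) * g (suc n) + (scalePS a (tail f) *PS g) n     ≈⟨ +-cong (*-assoc _ _ _) (scalePS-* a (tail f) g n) ⟩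
    a * (f 0 * g (suc n)) + a * (tail f *PS g) n             ≈⟨ distribˡ _ _ _ ⟨
    a * (f 0 * g (suc n) + (tail f *PS g) n)                 ≈⟨ *-congˡ (*PS-suc f g n) ⟨
    a * (f *PS g) (suc n)                                    ∎

  *PS-assoc : ∀ f g h → ((f *PS g) *PS h) ≈PS (f *PS (g *PS h))
  *PS-assoc f g h zero = begin
    ((f *PS g) *PS h) 0    ≈⟨ *PS-zero (f *PS g) h ⟩
    (f *PS g) 0 * h 0      ≈⟨ *-congʳ (*PS-zero f g) ⟩
    (f 0 * g 0) * h 0      ≈⟨ *-assoc _ _ _ ⟩
    f 0 * (g 0 * h 0)      ≈⟨ *-congˡ (*PS-zero g h) ⟨
    f 0 * (g *PS h) 0      ≈⟨ *PS-zero f (g *PS h) ⟨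
    (f *PS (g *PS h)) 0    ∎
  *PS-assoc f g h (suc n) = begin
    ((f *PS g) *PS h) (suc n)
      ≈⟨ *PS-suc (f *PS g) h n ⟩
    (f *PS g) 0 * h (suc n) + (tail (f *PS g) *PS h) n
      ≈⟨ +-cong (trans (*-congʳ (*PS-zero f g)) (*-assoc _ _ _)) (*PS-cong {g = h} (*PS-suc f g) (λ _ → refl) n) ⟩
    f 0 * (g 0 * h (suc n)) + ((scalePS (f 0) (tail g) +PS (tail f *PS g)) *PS h) n
      ≈⟨ +-congˡ (*PS-distribʳ h (scalePS (f 0) (tail g)) (tail f *PS g) n) ⟩
    f 0 * (g 0 * h (suc n)) + ((scalePS (f 0) (tail g) *PS h) n + ((tail f *PS g) *PS h) n)
      ≈⟨ +-congˡ (+-cong (scalePS-* (f 0) (tail g) h n) (*PS-assoc (tail f) g h n)) ⟩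
    f 0 * (g 0 * h (suc n)) + (f 0 * (tail g *PS h) n + (tail f *PS (g *PS h)) n)
      ≈⟨ +-assoc _ _ _ ⟨
    (f 0 * (g 0 * h (suc n)) + f 0 * (tail g *PS h) n) + (tail f *PS (g *PS h)) n
      ≈⟨ +-congʳ (trans (sym (distribˡ _ _ _)) (*-congˡ (sym (*PS-suc g h n)))) ⟩
    f 0 * (g *PS h) (suc n) + (tail f *PS (g *PS h)) n
      ≈⟨ *PS-suc f (g *PS h) n ⟨
    (f *PS (g *PS h)) (suc n) ∎

  *PS-zeroˡ : ∀ f → (0PS *PS f) ≈PS 0PS
  *PS-zeroˡ f zero    = trans (*PS-zero 0PS f) (zeroˡ _)
  *PS-zeroˡ f (suc n) = trans (*PS-suc 0PS f n) (trans (+-cong (zeroˡ _) (*PS-zeroˡ f n)) (+-identityˡ _))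

  C : Carrier → PS
  C x zero    = x
  C x (suc _) = 0#

  C-*PS : ∀ x f → (C x *PS f) ≈PS scalePS x f
  C-*PS x f zero    = *PS-zero (C x) f
  C-*PS x f (suc n) = trans (*PS-suc (C x) f n) (trans (+-congˡ (*PS-zeroˡ f n)) (+-identityʳ _))

  1PS≈C1 : 1PS ≈PS C 1#
  1PS≈C1 zero    = refl
  1PS≈C1 (suc n) = refl

  *PS-identityˡ : ∀ f → (1PS *PS f) ≈PS f
  *PS-identityˡ f n = begin
    (1PS *PS f) n   ≈⟨ *PS-cong {g = f} 1PS≈C1 (λ _ → refl) n ⟩
    (C 1# *PS f) n  ≈⟨ C-*PS 1# f n ⟩
    1# * f n        ≈⟨ *-identityˡ _ ⟩
    f n             ∎

  powerSeriesRing : CommutativeRing c ℓ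
  powerSeriesRing = record
    { Carrier = PS ; _≈_ = _≈PS_ ; _+_ = _+PS_ ; _*_ = _*PS_ ; -_ = λ f n → - f n ; 0# = 0PS ; 1# = 1PS
    ; isCommutativeRing = record
      { isRing = record
        { +-isAbelianGroup = record
          { isGroup = record
            { isMonoid = record
              { isSemigroup = record
                { isMagma = record
                  { isEquivalence = record
                    { refl  = λ _ → refl
                    ; sym   = λ e n → sym (e n)
                    ; trans = λ e e′ n → trans (e n) (e′ n)
                    }
                  ; ∙-cong = λ e e′ n → +-cong (e n) (e′ n)
                  }
                ; assoc = λ f g h n → +-assoc _ _ _
                }
              ; identity = (λ f n → +-identityˡ _) , (λ f n → +-identityʳ _)
              }
            ; inverse = (λ f n → -‿inverseˡ _) , (λ f n → -‿inverseʳ _)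
            ; ⁻¹-cong = λ e n → -‿cong (e n)
            }
          ; comm = λ f g n → +-comm _ _
          }
        ; *-cong = *PS-cong
        ; *-assoc = *PS-assoc
        ; *-identity = *PS-identityˡ , λ f n → trans (*PS-comm f 1PS n) (*PS-identityˡ f n)
        ; distrib = (λ h f g n → trans (*PS-comm h (f +PS g) n)
                       (trans (*PS-distribʳ h f g n) (+-cong (*PS-comm f h n) (*PS-comm g h n))))
                  , *PS-distribʳ
        }
      ; *-comm = *PS-comm
      }
    }

  X : PS
  X zero    = 0#
  X (suc n) = 1PS n

  X-*PS-zero : ∀ f → (X *PS f) 0 ≈ 0#
  X-*PS-zero f = trans (*PS-zero X f) (zeroˡ _)

  X-*PS-suc : ∀ f n → (X *PS f) (suc n) ≈ f n
  X-*PS-suc f n = trans (*PS-suc X f n) (trans (+-cong (zeroˡ _) (*PS-identityˡ f n)) (+-identityˡ _))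

  invUpTo-map : ∀ u n → invUpTo u n ≡ map (λ k → invPS₁ u (n ℕ.∸ k)) (upTo (suc n))
  invUpTo-map u zero    = ≡.refl
  invUpTo-map u (suc n) = ≡.cong (invPS₁ u (suc n) ∷_) (≡.trans (invUpTo-map u n)
    (≡.trans (map-upTo _ (suc n)) (≡.sym (map-applyUpTo suc _ (suc n)))))

  zipWith-map : ∀ (f g : ℕ → Carrier) ks → zipWith _*_ (map f ks) (map g ks) ≡ map (λ k → f k * g k) ks
  zipWith-map f g []       = ≡.refl
  zipWith-map f g (k ∷ ks) = ≡.cong (f k * g k ∷_) (zipWith-map f g ks)

  -- The recursion for the inverse is the vanishing of coefficient `suc n`, solved for the newest
  -- entry. As `invUpTo` lists its entries in descending order, `zipWith` computes the convolution.
  invPS₁-inverse : ∀ u → u 0 ≈ 1# → (u *PS invPS₁ u) ≈PS 1PS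
  invPS₁-inverse u u₀≈1 zero    = trans (*PS-zero u (invPS₁ u)) (trans (*-identityʳ _) u₀≈1)
  invPS₁-inverse u u₀≈1 (suc n) = begin
    (u *PS invPS₁ u) (suc n)                       ≈⟨ *PS-suc u (invPS₁ u) n ⟩
    u 0 * invPS₁ u (suc n) + (tail u *PS invPS₁ u) n
      ≈⟨ +-cong (trans (*-congʳ u₀≈1) (*-identityˡ _)) (reflexive (≡.sym (≡.cong Σl convolution))) ⟩
    - s + s                                        ≈⟨ -‿inverseˡ _ ⟩
    0#                                             ∎
    where
    s : Carrier
    s = Σl (zipWith _*_ (map (tail u) (upTo (suc n))) (invUpTo u n))
    convolution : zipWith _*_ (map (tail u) (upTo (suc n))) (invUpTo u n)
                ≡ map (λ k → tail u k * invPS₁ u (n ℕ.∸ k)) (upTo (suc n))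
    convolution = ≡.trans (≡.cong (zipWith _*_ (map (tail u) (upTo (suc n)))) (invUpTo-map u n))
                          (zipWith-map (tail u) (λ k → invPS₁ u (n ℕ.∸ k)) (upTo (suc n)))

  T : ∀ {d} → Monic d → PS
  T v = Vec.foldr (λ _ → PS) (λ x t → X *PS (C x +PS t)) 0PS v

  T-zero : ∀ {d} (v : Monic d) → T v 0 ≈ 0#
  T-zero []      = refl
  T-zero (x ∷ v) = X-*PS-zero (C x +PS T v)

  -- `T` is the nonconstant part in Horner form, which links the coefficientwise definition to the
  -- abstract ring.
  normPS≈1+T : ∀ {d} (v : Monic d) → normPS v ≈PS (1PS +PS T v)
  normPS≈1+T v       zero          = sym (trans (+-congˡ (T-zero v)) (+-identityʳ _))
  normPS≈1+T []      (suc k)       = sym (+-identityʳ _)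
  normPS≈1+T (x ∷ v) (suc zero)    = sym (trans (+-identityˡ _)
    (trans (X-*PS-suc (C x +PS T v) 0) (trans (+-congˡ (T-zero v)) (+-identityʳ _))))
  normPS≈1+T (x ∷ v) (suc (suc k)) = trans (normPS≈1+T v (suc k))
    (+-congˡ (sym (trans (X-*PS-suc (C x +PS T v) (suc k)) (+-identityˡ _))))

  seriesRing : SeriesRing F c ℓ
  seriesRing = record
    { commutativeRing = powerSeriesRing
    ; C      = C
    ; C-cong = λ { e zero → e ; e (suc n) → refl }
    ; C-+    = λ { x y zero → refl ; x y (suc n) → sym (+-identityʳ _) }
    ; C-*    = λ { x y zero → sym (C-*PS x (C y) 0) ; x y (suc n) → sym (trans (C-*PS x (C y) (suc n)) (zeroʳ _)) }
    ; C-1    = λ n → sym (1PS≈C1 n)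
    ; X      = X
    ; V      = λ v → invPS₁ (normPS v)
    ; V-inverse = λ v n → trans (*PS-cong {g = invPS₁ (normPS v)} (λ k → sym (normPS≈1+T v k)) (λ _ → refl) n)
                                (invPS₁-inverse (normPS v) refl n)
    }

-- Comparison of truncated sums with the actual multizeta values.

module Values {c ℓ} (F : FiniteField c ℓ) where
  open FiniteField F
  open Zeta F
  open PowerSeries F
  private
    module 𝔽′ = RingFacts commRing
    module P = CommutativeRing powerSeriesRing
  open RingFacts powerSeriesRing
    using (∑; ∑-cong; *-∑; ∑-*; σ-cong; ∑-upTo) renaming (_^_ to _^P_; ^-congˡ to ^P-congˡ)
  module H = Harmonic F seriesRing
  open H using (Word; weight; twist; Valid; Combination; nil; cons; admissible)

  ^≡^ : ∀ x n → (x ^ n) ≡ x 𝔽′.^ n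
  ^≡^ x zero    = ≡.refl
  ^≡^ x (suc n) = ≡.cong (x *_) (^≡^ x n)

  ^PS≡^ : ∀ f n → (f ^PS n) ≡ f ^P n
  ^PS≡^ f zero    = ≡.refl
  ^PS≡^ f (suc n) = ≡.cong (f *PS_) (^PS≡^ f n)

  shiftPS-zero : ∀ f → shiftPS 0 f ≈PS f
  shiftPS-zero f n = refl

  shiftPS-suc : ∀ d f → shiftPS (suc d) f ≈PS (X *PS shiftPS d f)
  shiftPS-suc d f zero    = sym (X-*PS-zero (shiftPS d f))
  shiftPS-suc d f (suc n) = trans step (sym (X-*PS-suc (shiftPS d f) n))
    where
    step : shiftPS (suc d) f (suc n) ≈ shiftPS d f n
    step with d ℕ.≤? n | suc d ℕ.≤? suc n
    ... | yes _   | yes _       = refl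
    ... | no  _   | no  _       = refl
    ... | yes d≤n | no  d≰n     = ⊥-elim (d≰n (s≤s d≤n))
    ... | no  d≰n | yes (s≤s p) = ⊥-elim (d≰n p)

  shiftPS≈X^ : ∀ d f → shiftPS d f ≈PS ((X ^P d) *PS f)
  shiftPS≈X^ zero    f = P.trans (shiftPS-zero f) (P.sym (P.*-identityˡ f))
  shiftPS≈X^ (suc d) f = P.trans (shiftPS-suc d f)
    (P.trans (P.*-congˡ {X} (shiftPS≈X^ d f)) (P.sym (P.*-assoc X (X ^P d) f)))

  recipPS^≈α^ : ∀ {d} (v : Monic d) s → (recipPS v ^PS s) ≈PS (H.α v ^P s)
  recipPS^≈α^ {d} v s = P.trans (P.reflexive (^PS≡^ (recipPS v) s))
                                (^P-congˡ s (shiftPS≈X^ d (invPS₁ (normPS v))))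

  Z≈Z : ∀ N w → Z N w ≈PS H.Z N w
  Z≈Z N []            = P.refl
  Z≈Z N ((s , e) ∷ w) = P.trans (∑-upTo N _) (σ-cong N layer)
    where
    layer : ∀ d → ∑ (monics d) (λ v → scalePS (e ^ d) ((recipPS v ^PS s) *PS Z d w))
            ≈PS (H.K d s e *PS H.Z d w)
    layer d = begin
      ∑ (monics d) (λ v → scalePS (e ^ d) ((recipPS v ^PS s) *PS Z d w))
        ≈⟨ ∑-cong (monics d) (λ v → P.trans (P.sym (C-*PS (e ^ d) ((recipPS v ^PS s) *PS Z d w)))
             (P.*-cong (P.reflexive (≡.cong C (^≡^ e d))) (P.*-cong (recipPS^≈α^ v s) (Z≈Z d w)))) ⟩
      ∑ (monics d) (λ v → C (e 𝔽′.^ d) *PS ((H.α v ^P s) *PS H.Z d w))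
        ≈⟨ *-∑ (C (e 𝔽′.^ d)) (monics d) _ ⟨
      C (e 𝔽′.^ d) *PS ∑ (monics d) (λ v → (H.α v ^P s) *PS H.Z d w)
        ≈⟨ P.*-congˡ {C (e 𝔽′.^ d)} (∑-* (H.Z d w) (monics d) _) ⟨
      C (e 𝔽′.^ d) *PS (H.S d s *PS H.Z d w)
        ≈⟨ P.*-assoc (C (e 𝔽′.^ d)) (H.S d s) (H.Z d w) ⟨
      H.K d s e *PS H.Z d w ∎
      where open import Relation.Binary.Reasoning.Setoid P.setoid

  Order≥ : ℕ → PS → Set ℓ
  Order≥ d f = ∀ n → n < d → f n ≈ 0#

  order-*ˡ : ∀ {d f} g → Order≥ d f → Order≥ d (f *PS g)
  order-*ˡ g f≥d n n<d = trans
    (*PS-local {g′ = g} n (λ k k≤n → f≥d k (<-≤-trans (s≤s k≤n) n<d)) (λ _ _ → refl)) (*PS-zeroˡ g n)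

  order-*ʳ : ∀ {d f} g → Order≥ d f → Order≥ d (g *PS f)
  order-*ʳ {f = f} g f≥d n n<d = trans (*PS-comm g f n) (order-*ˡ g f≥d n n<d)

  order-X^ : ∀ d → Order≥ d (X ^P d)
  order-X^ (suc d) zero    _         = X-*PS-zero (X ^P d)
  order-X^ (suc d) (suc n) (s≤s n<d) = trans (X-*PS-suc (X ^P d) n) (order-X^ d n n<d)

  order-∑ : ∀ {i} {A : Set i} {d} (xs : List A) {f : A → PS} → (∀ x → Order≥ d (f x)) → Order≥ d (∑ xs f)
  order-∑ []       f≥d n n<d = refl
  order-∑ (x ∷ xs) f≥d n n<d = trans (+-cong (f≥d x n n<d) (order-∑ xs f≥d n n<d)) (+-identityˡ _)

  -- One reciprocal of a polynomial of degree `d` already contributes `X ^ d`, and `1 ≤ s`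
  -- guarantees that one is present.
  order-S : ∀ d {s} → 1 ≤ s → Order≥ d (H.S d s)
  order-S d {suc s} _ = order-∑ (monics d) (λ v →
    order-*ˡ (H.α v ^P s) (order-*ˡ (invPS₁ (normPS v)) (order-X^ d)))

  -- Raising the truncation from `N` to `suc N` adds the layer of leading degree `N`, whose order is
  -- at least `N > n`.
  Z-stable : ∀ {w} → Valid w → ∀ {n N} → n < N → H.Z N w n ≈ H.Z (suc n) w n
  Z-stable [] n<N = refl
  Z-stable {(s , e) ∷ w} ((s≥1 , _) ∷ _) {n} n<N = go (≤⇒≤′ n<N)
    where
    go : ∀ {N} → suc n ≤′ N → H.Z N ((s , e) ∷ w) n ≈ H.Z (suc n) ((s , e) ∷ w) n
    go ≤′-refl             = refl
    go (≤′-step {N} n<′N)  = trans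
      (+-cong (go n<′N) (order-*ˡ (H.Z N w) (order-*ʳ (C (e 𝔽′.^ N)) (order-S N s≥1)) n (≤′⇒≤ n<′N)))
      (+-identityʳ _)

  -- Translation between words and pairs of vectors.

  word : ∀ {r} → Vec ℕ r → Vec Carrier r → Word
  word 𝔰 ε = Vec.toList (Vec.zip 𝔰 ε)

  length-word : ∀ {r} (𝔰 : Vec ℕ r) ε → length (word 𝔰 ε) ≡ r
  length-word []      []      = ≡.refl
  length-word (s ∷ 𝔰) (e ∷ ε) = ≡.cong suc (length-word 𝔰 ε)

  weight-word : ∀ {r} (𝔰 : Vec ℕ r) ε → weight (word 𝔰 ε) ≡ ΣVℕ 𝔰
  weight-word []      []      = ≡.refl
  weight-word (s ∷ 𝔰) (e ∷ ε) = ≡.cong (s ℕ.+_) (weight-word 𝔰 ε)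

  twist-word : ∀ {r} (𝔰 : Vec ℕ r) ε → twist (word 𝔰 ε) ≡ ΠV ε
  twist-word []      []      = ≡.refl
  twist-word (s ∷ 𝔰) (e ∷ ε) = ≡.cong (e *_) (twist-word 𝔰 ε)

  valid-word : ∀ {r} {𝔰 : Vec ℕ r} {ε} → VAll.All (1 ≤_) 𝔰 → VAll.All (λ e → ¬ (e ≈ 0#)) ε → Valid (word 𝔰 ε)
  valid-word VAll.[]       VAll.[]       = []
  valid-word (s≥1 VAll.∷ 𝔰≥1) (e≉0 VAll.∷ ε≉0) = (s≥1 , e≉0) ∷ valid-word 𝔰≥1 ε≉0

  exponents : (w : Word) → Vec ℕ (length w)
  exponents w = Vec.map proj₁ (Vec.fromList w)

  twists : (w : Word) → Vec Carrier (length w)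
  twists w = Vec.map proj₂ (Vec.fromList w)

  word-η : ∀ w → word (exponents w) (twists w) ≡ w
  word-η []      = ≡.refl
  word-η (t ∷ w) = ≡.cong (t ∷_) (word-η w)

  valid-exponents : ∀ {w} → Valid w → VAll.All (1 ≤_) (exponents w)
  valid-exponents []              = VAll.[]
  valid-exponents ((s≥1 , _) ∷ v) = s≥1 VAll.∷ valid-exponents v

  valid-twists : ∀ {w} → Valid w → VAll.All (λ e → ¬ (e ≈ 0#)) (twists w)
  valid-twists []              = VAll.[]
  valid-twists ((_ , e≉0) ∷ v) = e≉0 VAll.∷ valid-twists v

  AdmissibleSummand : ℕ → Carrier → ℕ → Summand → Set (c ⊔ ℓ)
  AdmissibleSummand n p l t = Summand.l t ≤ l
    × VAll.All (1 ≤_) (Summand.cs t)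
    × VAll.All (λ μ → ¬ (μ ≈ 0#)) (Summand.μs t)
    × n ≡ ΣVℕ (Summand.cs t)
    × p ≈ ΠV (Summand.μs t)

  ζ-combination : List Summand → PS
  ζ-combination I = ΣPS (map (λ t → scalePS (fromℕ (Summand.f t)) (ζA (Summand.cs t) (Summand.μs t))) I)

  -- Coefficient `k` is read at truncation `suc k`, the one built into `ζA`; a single list serves
  -- all `k` because the combination does not depend on the truncation.
  summands : ∀ {n p l G} → Combination n p l G →
    ∃ λ I → All (AdmissibleSummand n p l) I × (∀ k → G (suc k) k ≈ ζ-combination I k)
  summands (nil G≈0) = [] , [] , λ k → G≈0 (suc k) k
  summands {n} {p} (cons f w H (admissible valid length≤ weight≡ twist≈) h G≈) with summands h
  ... | I , I-adm , H≈ =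
    summand (length w) (exponents w) (twists w) f ∷ I
    , (length≤ , valid-exponents valid , valid-twists valid , n≡ , p≈) ∷ I-adm
    , λ k → trans (G≈ (suc k) k) (+-cong (term k) (H≈ k))
    where
    n≡ : n ≡ ΣVℕ (exponents w)
    n≡ = ≡.trans (≡.sym weight≡) (≡.trans (≡.cong weight (≡.sym (word-η w))) (weight-word (exponents w) (twists w)))
    p≈ : p ≈ ΠV (twists w)
    p≈ = trans (sym twist≈) (reflexive
           (≡.trans (≡.cong twist (≡.sym (word-η w))) (twist-word (exponents w) (twists w))))
    term : ∀ k → (C (fromℕ f) *PS H.Z (suc k) w) k ≈ fromℕ f * ζA (exponents w) (twists w) k
    term k = trans (C-*PS (fromℕ f) (H.Z (suc k) w) k) (*-congˡ (trans (sym (Z≈Z (suc k) w k))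
               (reflexive (≡.cong (λ u → Z (suc k) u k) (≡.sym (word-η w))))))

  -- In the convolution the coefficients with index `k ≤ n` come from different truncations `suc k`;
  -- stability moves them all to `suc n`, where the product of truncated values has been expanded.
  ζA-product : ∀ {r s} (𝔞 : Vec ℕ r) (𝔟 : Vec ℕ s) ε λ′ → Valid (word 𝔞 ε) → Valid (word 𝔟 λ′) →
    ∀ n → (ζA 𝔞 ε *PS ζA 𝔟 λ′) n ≈ (H.Z (suc n) (word 𝔞 ε) *PS H.Z (suc n) (word 𝔟 λ′)) n
  ζA-product 𝔞 𝔟 ε λ′ valid-a valid-b n = *PS-local n (truncate valid-a) (truncate valid-b)
    where
    truncate : ∀ {w} → Valid w → ∀ k → k ≤ n → Z (suc k) w k ≈ H.Z (suc n) w k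
    truncate {w} valid k k≤n = trans (Z≈Z (suc k) w k) (sym (Z-stable valid (s≤s k≤n)))

theorem2p8 : ∀ {c ℓ} (F : FiniteField c ℓ) →
    let open FiniteField F
        open Zeta F
    in ∀ (r s : ℕ) → 1 ≤ r → 1 ≤ s →
       (𝔞 : Vec ℕ r) (𝔟 : Vec ℕ s) (ε : Vec Carrier r) (λ′ : Vec Carrier s) →
       VAll.All (1 ≤_) 𝔞 → VAll.All (1 ≤_) 𝔟 →
       VAll.All (λ e → ¬ (e ≈ 0#)) ε → VAll.All (λ e → ¬ (e ≈ 0#)) λ′ →
       ∃ λ (I : List Summand) →
         All (λ t → Summand.l t ≤ r ℕ.+ s
                  × VAll.All (1 ≤_) (Summand.cs t)
                  × VAll.All (λ μ → ¬ (μ ≈ 0#)) (Summand.μs t)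
                  × ΣVℕ 𝔞 ℕ.+ ΣVℕ 𝔟 ≡ ΣVℕ (Summand.cs t)
                  × (ΠV ε * ΠV λ′) ≈ ΠV (Summand.μs t)) I
         × ((ζA 𝔞 ε *PS ζA 𝔟 λ′)
             ≈PS ΣPS (map (λ t → scalePS (fromℕ (Summand.f t)) (ζA (Summand.cs t) (Summand.μs t))) I))
theorem2p8 F r s _ _ 𝔞 𝔟 ε λ′ 𝔞≥1 𝔟≥1 ε≉0 λ′≉0 = conclude (summands combination)
  where
  open FiniteField F
  open Zeta F
  open Values F
  u w : H.Word
  u = word 𝔞 ε
  w = word 𝔟 λ′
  combination : H.Combination (ΣVℕ 𝔞 ℕ.+ ΣVℕ 𝔟) (ΠV ε * ΠV λ′) (r ℕ.+ s) (λ N → H.Z N u *PS H.Z N w)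
  combination = H.comb-weaken
    (≡.cong₂ ℕ._+_ (weight-word 𝔞 ε) (weight-word 𝔟 λ′))
    (reflexive (≡.cong₂ _*_ (twist-word 𝔞 ε) (twist-word 𝔟 λ′)))
    (≤-reflexive (≡.cong₂ ℕ._+_ (length-word 𝔞 ε) (length-word 𝔟 λ′)))
    (H.comb-product _ u w ≤-refl (valid-word 𝔞≥1 ε≉0) (valid-word 𝔟≥1 λ′≉0))
  conclude : (∃ λ I → All (AdmissibleSummand (ΣVℕ 𝔞 ℕ.+ ΣVℕ 𝔟) (ΠV ε * ΠV λ′) (r ℕ.+ s)) I
                    × (∀ k → (H.Z (suc k) u *PS H.Z (suc k) w) k ≈ ζ-combination I k)) → _
  conclude (I , I-adm , I≈) = I , I-adm , λ n →
    trans (ζA-product 𝔞 𝔟 ε λ′ (valid-word 𝔞≥1 ε≉0) (valid-word 𝔟≥1 λ′≉0) n) (I≈ n)
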